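{- For every integer $p \geqslant 4$, $$\gamma_4(K_p) = \left\lceil \frac{p(p-5)}{8} \right\rceil + 1,$$ where $K_p$ is the complete graph on $p$ vertices.
   Context: Given a 2-cell embedding of a graph in a surface, the length of a face is the number of edges on its boundary (counted with multiplicity along the boundary walk). For a graph $G$ and an integer $n \geqslant 3$, the $n$-genus $\gamma_n(G)$ is the minimum genus $h$ of a closed orientable surface $S_h$ in which $G$ has a 2-cell embedding in which every face has length at least $n$. Thus $\gamma_4(K_p)$ is the minimum genus of a closed orientable surface admitting a 2-cell embedding of $K_p$ with no faces of length less than $4$. -}

module Defs where

open import Data.Nat using (ℕ; zero; suc; _+_; _*_; _∸_; _/_; _≤_; _<_; _≤ᵇ_)
open import Data.Fin using (Fin; toℕ)
open import Data.Fin.Properties using () renaming (_≟_ to _≟ᶠ_)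
open import Data.Bool using (Bool; not)
open import Data.Product using (Σ; ∃; _×_; _,_; proj₁; proj₂)
open import Data.List using (List; length; filterᵇ; upTo; allFin; concatMap; map)
open import Relation.Binary.PropositionalEquality using (_≡_; _≢_)
open import Relation.Nullary.Decidable using (⌊_⌋)
open import Data.Bool.ListAction using (all)

iter : {A : Set} → (A → A) → ℕ → A → A
iter f zero    x = x
iter f (suc k) x = f (iter f k x)

-- A rotation system for the complete graph K_p on vertex set Fin p:
-- for each vertex u, σ u is a cyclic permutation of the neighbours of u
-- (all vertices other than u): it maps neighbours to neighbours, is injective
-- on them, and any neighbour is reached from any other by iterating σ u
-- (so the neighbours form a single cycle).
record Rotation (p : ℕ) : Set where
  field
    σ     : Fin p → Fin p → Fin p
    avoid : ∀ u v → v ≢ u → σ u v ≢ u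
    inj   : ∀ u v w → v ≢ u → w ≢ u → σ u v ≡ σ u w → v ≡ w
    cyc   : ∀ u v w → v ≢ u → w ≢ u → ∃ λ k → iter (σ u) k v ≡ w

open Rotation public

Dart : ℕ → Set
Dart p = Fin p × Fin p

-- Face-tracing permutation (Heffter–Edmonds): after traversing the dart
-- (u , v) we continue with (v , σ v u).
faceStep : {p : ℕ} → Rotation p → Dart p → Dart p
faceStep R (u , v) = (v , σ R v u)

darts : (p : ℕ) → List (Dart p)
darts p = filterᵇ (λ d → not ⌊ proj₁ d ≟ᶠ proj₂ d ⌋)
                  (concatMap (λ u → map (λ v → (u , v)) (allFin p)) (allFin p))

dartIndex : {p : ℕ} → Dart p → ℕ
dartIndex {p} (u , v) = toℕ u * p + toℕ v

-- A dart is the representative of its face if it has the least index in its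
-- faceStep-orbit (orbits have size < p * p, so k < p * p covers the orbit).
isFaceRep : {p : ℕ} → Rotation p → Dart p → Bool
isFaceRep {p} R d = all (λ k → dartIndex d ≤ᵇ dartIndex (iter (faceStep R) k d)) (upTo (p * p))

numFaces : {p : ℕ} → Rotation p → ℕ
numFaces {p} R = length (filterᵇ (isFaceRep R) (darts p))

FacesAtLeast : {p : ℕ} → ℕ → Rotation p → Set
FacesAtLeast {p} n R =
  ∀ (u v : Fin p) → u ≢ v → ∀ k → 1 ≤ k → k < n → iter (faceStep R) k (u , v) ≢ (u , v)

-- K_p has a 2-cell embedding in the orientable surface S_h with all faces of
-- length ≥ n: a rotation system with faces of length ≥ n whose Euler
-- characteristic V − E + F equals 2 − 2h, i.e. 2(p + F + 2h) = 4 + 2E where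
-- 2E = p(p−1).
EmbedsIn : ℕ → ℕ → ℕ → Set
EmbedsIn n p h = Σ (Rotation p) λ R →
  FacesAtLeast n R × (2 * (p + numFaces R + 2 * h) ≡ 4 + p * (p ∸ 1))

NGenusComplete≡ : ℕ → ℕ → ℕ → Set
NGenusComplete≡ n p h = EmbedsIn n p h × (∀ h′ → EmbedsIn n p h′ → h ≤ h′)

-- Lower bound: distinct faces of length at least 4 use up at least four darts each, so 4 F ≤ p (p − 1), and Euler's
-- formula turns this into the bound on the genus.
--
-- Upper bound: by the same formula it is enough to embed K_p so that all faces are quadrilaterals except for one of
-- length 4 + e with e ≤ 6.  Such an embedding of K_{p+8} is obtained from one of K_p as follows.  All vertices, or
-- all but one vertex r when p is odd, are matched into pairs (x , y) of opposite orientation that lie opposite each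
-- other on a quadrilateral l x f y of their own.  Eight new vertices 0, …, 7 are inserted in this order into the
-- corners of these quadrilaterals at x and at y, and the new vertices go round the old ones pair after pair, the even
-- ones forwards and the odd ones backwards; since orientations alternate along both orders, all faces that arise are
-- quadrilaterals.  The edges among the new vertices (and those to r) are then added inside five (for even p, four)
-- of these faces, by a fixed pattern.  The new vertices form pairs with quadrilaterals of their own again, so the
-- step can be iterated.  The starting embeddings for 7 ≤ p ≤ 14 and the patterns were found by a computer search.
module Submission where

open import Defs
open import Data.Nat using (ℕ; zero; suc; _+_; _*_; _∸_; _/_; _%_; _≤_; _<_; z≤n; s≤s; NonZero; >-nonZero)
open import Data.Nat.Properties
open import Data.Nat.Divisibility using (_∣_; n∣m*n)
open import Data.Nat.DivMod
open import Data.Nat.ListAction using (sum)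
open import Data.Nat.ListAction.Properties using (sum-↭)
open import Data.Nat.Tactic.RingSolver using (solve-∀)
open import Data.Bool using (Bool; true; false; T; not; if_then_else_; _∧_; _∨_)
import Data.Bool.Properties as Bool
open import Data.Bool.ListAction using (any)
open import Data.Unit using (tt)
open import Data.Empty using (⊥-elim)
open import Data.Maybe using (Maybe; just; nothing; _>>=_; to-witness-T)
import Data.Maybe as Maybe
open import Data.Fin using (Fin; zero; suc; toℕ; combine; splitAt; _↑ˡ_; _↑ʳ_)
open import Data.Fin.Patterns
import Data.Fin.Properties as Fin
open import Data.Product using (∃; ∃₂; Σ; _×_; _,_; proj₁; proj₂)
import Data.Product as Product
open import Data.Product.Properties using (,-injective; ≡-dec)
open import Data.Sum using (_⊎_; inj₁; inj₂; [_,_]′)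
import Data.Sum as Sum
open import Data.Sum.Function.Propositional using (_⊎-↔_)
open import Data.Sum.Properties using (inj₁-injective; inj₂-injective)
open import Data.List using (List; []; _∷_; _++_; [_]; map; length; reverse; filter; filterᵇ; allFin; upTo; concatMap; cartesianProduct; zip)
open import Data.List.Properties using (unfold-reverse; ++-assoc; ++-identityʳ; map-++; map-∘; map-id; length-++; length-map; length-tabulate)
open import Data.List.Membership.Propositional using (_∈_; _∉_)
open import Data.List.Membership.Propositional.Properties
open import Data.List.Membership.Propositional.Properties.WithK using (unique∧set⇒bag)
import Data.List.Membership.DecPropositional as DecMembership
open import Data.List.Relation.Binary.BagAndSetEquality using (∼bag⇒↭)
open import Data.List.Relation.Binary.Permutation.Propositional using (_↭_; ↭-refl; ↭-sym; ↭-trans; ↭-reflexive; prep; ↭⇒↭ₛ; module PermutationReasoning)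
import Data.List.Relation.Binary.Permutation.Propositional.Properties as Perm
import Data.List.Relation.Binary.Permutation.Setoid.Properties as PermS
open import Data.List.Relation.Unary.All using ([]; _∷_)
import Data.List.Relation.Unary.All as All
import Data.List.Relation.Unary.All.Properties as All
open import Data.List.Relation.Unary.AllPairs using ([]; _∷_)
open import Data.List.Relation.Unary.Any using (Any; here; there)
open import Data.List.Relation.Unary.Unique.Propositional using (Unique)
import Data.List.Relation.Unary.Unique.Propositional.Properties as Unique
import Data.List.Relation.Unary.Unique.DecPropositional as DecUnique
open import Algebra.Properties.CommutativeSemigroup +-commutativeSemigroup using (interchange)
import Algebra.Solver.CommutativeMonoid
open import Function using (_∘_; id)
open import Function.Bundles using (_↔_; mk⇔; Inverse)
open import Function.Properties.Inverse using (↔-refl; ↔-sym; ↔-trans)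
open import Relation.Binary.PropositionalEquality hiding ([_])
open import Relation.Binary.Definitions using (DecidableEquality)
open import Relation.Nullary using (Dec; yes; no; does; ¬_; contradiction)
open import Relation.Nullary.Decidable using (⌊_⌋; ¬?; dec⇒maybe; map′)

-- From `p` to `p + 8` the number `p (p - 5)` grows by `16 p + 24`, a multiple of 8. So the excess
-- `e` that makes `p (p - 5) + e` a multiple of 8 is the same at every stage, and the exceptional
-- face of the starting embedding can be carried along unchanged. The excess is even because
-- `p (p - 5)` is, hence at most 6. The difficulty is that the old vertices are unboundedly many
-- while the pattern among the new ones is finite. Each neighbour list is therefore cut at the
-- corner where insertion takes place: adjacencies inside the list survive every later step, and
-- only the quadrilaterals at the cuts have to be followed. The pattern refers to twelve locations,
-- is verified once by evaluation, and is carried over to any vertex set by a map that preserves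
-- rotation steps. One pair `(a , b)` takes the new vertices at the front of its lists, next to the
-- pattern; the new pair `(2 , 3)` then takes over its role. Faces are counted without decomposing
-- the darts into orbits: the representatives met among the first `n` iterates are summed over all
-- starting darts.

-- Linear and cyclic adjacency in lists

data Adj {A : Set} : List A → A → A → Set where
  here  : ∀ {x y l} → Adj (x ∷ y ∷ l) x y
  there : ∀ {x y z l} → Adj l x y → Adj (z ∷ l) x y

data First {A : Set} : List A → A → Set where
  first : ∀ {x l} → First (x ∷ l) x

data Last {A : Set} : List A → A → Set where
  last  : ∀ {x} → Last (x ∷ []) x
  there : ∀ {x y l} → Last l x → Last (y ∷ l) x

CAdj : {A : Set} → List A → A → A → Set
CAdj l x y = Adj l x y ⊎ (Last l x × First l y)

module _ {A : Set} where

  Adj-++ˡ : ∀ {l m : List A} {x y} → Adj l x y → Adj (l ++ m) x y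
  Adj-++ˡ here      = here
  Adj-++ˡ (there q) = there (Adj-++ˡ q)

  Adj-++ʳ : ∀ l {m : List A} {x y} → Adj m x y → Adj (l ++ m) x y
  Adj-++ʳ []      q = q
  Adj-++ʳ (_ ∷ l) q = there (Adj-++ʳ l q)

  Adj-join : ∀ {l m : List A} {x y} → Last l x → First m y → Adj (l ++ m) x y
  Adj-join last      first = here
  Adj-join (there p) q     = there (Adj-join p q)

  First-++ : ∀ {l m : List A} {x} → First l x → First (l ++ m) x
  First-++ first = first

  Last-++ : ∀ l {m : List A} {x} → Last m x → Last (l ++ m) x
  Last-++ []      q = q
  Last-++ (_ ∷ l) q = there (Last-++ l q)

  First-∈ : ∀ {l : List A} {x} → First l x → x ∈ l
  First-∈ first = here refl

  Last-∈ : ∀ {l : List A} {x} → Last l x → x ∈ l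
  Last-∈ last      = here refl
  Last-∈ (there q) = there (Last-∈ q)

  Adj-∈ˡ : ∀ {l : List A} {x y} → Adj l x y → x ∈ l
  Adj-∈ˡ here      = here refl
  Adj-∈ˡ (there q) = there (Adj-∈ˡ q)

  Adj-∈ʳ : ∀ {l : List A} {x y} → Adj l x y → y ∈ l
  Adj-∈ʳ here      = there (here refl)
  Adj-∈ʳ (there q) = there (Adj-∈ʳ q)

  CAdj-∈ˡ : ∀ {l : List A} {x y} → CAdj l x y → x ∈ l
  CAdj-∈ˡ (inj₁ q)       = Adj-∈ˡ q
  CAdj-∈ˡ (inj₂ (q , _)) = Last-∈ q

  CAdj-∈ʳ : ∀ {l : List A} {x y} → CAdj l x y → y ∈ l
  CAdj-∈ʳ (inj₁ q)       = Adj-∈ʳ q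
  CAdj-∈ʳ (inj₂ (_ , q)) = First-∈ q

  Adj-reverse : ∀ {l : List A} {x y} → Adj l x y → Adj (reverse l) y x
  Adj-reverse {x ∷ y ∷ l} here
    rewrite unfold-reverse x (y ∷ l) | unfold-reverse y l =
    Adj-join (Last-++ (reverse l) last) first
  Adj-reverse {z ∷ l} (there q)
    rewrite unfold-reverse z l = Adj-++ˡ (Adj-reverse q)

  First-reverse : ∀ {l : List A} {x} → First l x → Last (reverse l) x
  First-reverse {x ∷ l} first rewrite unfold-reverse x l = Last-++ (reverse l) last

  Last-reverse : ∀ {l : List A} {x} → Last l x → First (reverse l) x
  Last-reverse last = first
  Last-reverse {y ∷ l} (there q) rewrite unfold-reverse y l = First-++ (Last-reverse q)

  CAdj-reverse : ∀ {l : List A} {x y} → CAdj l x y → CAdj (reverse l) y x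
  CAdj-reverse (inj₁ q)       = inj₁ (Adj-reverse q)
  CAdj-reverse (inj₂ (p , q)) = inj₂ (First-reverse q , Last-reverse p)

  last-exists : ∀ x (l : List A) → ∃ (Last (x ∷ l))
  last-exists x []      = x , last
  last-exists x (y ∷ l) with last-exists y l
  ... | z , q = z , there q

  successor : ∀ {l : List A} {x} → x ∈ l → ∃ (CAdj l x)
  successor {z ∷ l} x∈ with go z l x∈
    where
    go : ∀ z l {x} → x ∈ z ∷ l → ∃ (Adj (z ∷ l) x) ⊎ Last (z ∷ l) x
    go z []      (here refl) = inj₂ last
    go z (y ∷ l) (here refl) = inj₁ (y , here)
    go z (y ∷ l) (there p) with go y l p
    ... | inj₁ (w , a) = inj₁ (w , there a)
    ... | inj₂ a       = inj₂ (there a)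
  ... | inj₁ (w , a) = w , inj₁ a
  ... | inj₂ a       = z , inj₂ (a , first)

  Unique-resp-↭ : ∀ {xs ys : List A} → xs ↭ ys → Unique xs → Unique ys
  Unique-resp-↭ q = PermS.Unique-resp-↭ (setoid A) (↭⇒↭ₛ q)

  CAdj-rotate₁ : ∀ {l : List A} {x y z} → CAdj (z ∷ l) x y → CAdj (l ++ [ z ]) x y
  CAdj-rotate₁ {_ ∷ l} (inj₁ here)              = inj₂ (Last-++ (_ ∷ l) last , first)
  CAdj-rotate₁         (inj₁ (there q))         = inj₁ (Adj-++ˡ q)
  CAdj-rotate₁         (inj₂ (last , first))    = inj₂ (last , first)
  CAdj-rotate₁         (inj₂ (there q , first)) = inj₁ (Adj-join q first)

  CAdj-rotate : ∀ m {l : List A} {x y} → CAdj (m ++ l) x y → CAdj (l ++ m) x y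
  CAdj-rotate []      {l} {x} {y} q = subst (λ k → CAdj k x y) (sym (++-identityʳ l)) q
  CAdj-rotate (z ∷ m) {l} {x} {y} q =
    subst (λ k → CAdj k x y) (++-assoc l [ z ] m)
      (CAdj-rotate m (subst (λ k → CAdj k x y) (++-assoc m l [ z ]) (CAdj-rotate₁ q)))

-- Iterating a map that follows a cyclic list

iter-+ : ∀ {A : Set} (f : A → A) m n x → iter f (m + n) x ≡ iter f m (iter f n x)
iter-+ f zero    n x = refl
iter-+ f (suc m) n x = cong f (iter-+ f m n x)

iter-shift : ∀ {A : Set} (f : A → A) n x → iter f n (f x) ≡ f (iter f n x)
iter-shift f zero    x = refl
iter-shift f (suc n) x = cong f (iter-shift f n x)

module Cycle {A : Set} (f : A → A) where

  walk-∈ : ∀ x l → (∀ {a b} → Adj (x ∷ l) a b → f a ≡ b) →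
           ∀ {k} → k < length l → iter f (suc k) x ∈ l
  walk-∈ x (y ∷ l) adj {zero}  _       = here (adj here)
  walk-∈ x (y ∷ l) adj {suc k} (s≤s q) =
    there (subst (_∈ l) (trans (cong (iter f (suc k)) (sym (adj here))) (iter-shift f (suc k) x))
                 (walk-∈ y l (λ a → adj (there a)) q))

  walk-last : ∀ x l → (∀ {a b} → Adj (x ∷ l) a b → f a ≡ b) →
              ∀ {z} → Last (x ∷ l) z → iter f (length l) x ≡ z
  walk-last x []      adj last      = refl
  walk-last x (y ∷ l) adj (there q) =
    trans (sym (iter-shift f (length l) x))
          (trans (cong (iter f (length l)) (adj here)) (walk-last y l (λ a → adj (there a)) q))

  walk-reach : ∀ x l → (∀ {a b} → Adj (x ∷ l) a b → f a ≡ b) →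
               ∀ {y} → y ∈ x ∷ l → ∃ λ k → iter f k x ≡ y
  walk-reach x l       adj (here refl) = 0 , refl
  walk-reach x (z ∷ l) adj (there q) with walk-reach z l (λ a → adj (there a)) q
  ... | k , eq = suc k , trans (sym (iter-shift f k x)) (trans (cong (iter f k) (adj here)) eq)

  module _ {T : List A} (adj : ∀ {a b} → CAdj T a b → f a ≡ b) where

    -- Cyclic adjacency does not depend on where the list is cut, so statements about an arbitrary
    -- element reduce to the head of a list.
    startAt : ∀ {x} → x ∈ T →
              ∃ λ l → (∀ {a b} → CAdj (x ∷ l) a b → f a ≡ b) × (x ∷ l ↭ T)
    startAt {x} x∈ with ∈-∃++ x∈
    ... | m , l , refl =
      l ++ m , (λ q → adj (CAdj-rotate (x ∷ l) q)) , Perm.++-comm (x ∷ l) m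

    cycle-reach : ∀ {x y} → x ∈ T → y ∈ T → ∃ λ k → iter f k x ≡ y
    cycle-reach x∈ y∈ with startAt x∈
    ... | l , adj′ , p = walk-reach _ l (λ a → adj′ (inj₁ a)) (Perm.∈-resp-↭ (↭-sym p) y∈)

    cycle-return : ∀ {x} → x ∈ T → iter f (length T) x ≡ x
    cycle-return {x} x∈ with startAt x∈
    ... | l , adj′ , p with last-exists x l
    ...   | z , q = trans (cong (λ n → iter f n x) (sym (Perm.↭-length p)))
                          (trans (cong f (walk-last x l (λ a → adj′ (inj₁ a)) q))
                                 (adj′ (inj₂ (q , first))))

    -- The first `length l` iterates of the head stay in the tail `l`, from which uniqueness
    -- excludes the head.
    cycle-noReturn : Unique T → ∀ {x} → x ∈ T → ∀ {k} → 0 < k → k < length T → iter f k x ≢ x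
    cycle-noReturn uniq {x} x∈ {suc k} _ k< eq with startAt x∈
    ... | l , adj′ , p with Unique-resp-↭ (↭-sym p) uniq
    ...   | x∉ ∷ _ =
      All.lookup x∉ (subst (_∈ l) eq (walk-∈ x l (λ a → adj′ (inj₁ a))
        (≤-pred (subst (suc k <_) (sym (Perm.↭-length p)) k<)))) refl

-- The cyclic permutation given by a list

module Next {A : Set} (_≟_ : DecidableEquality A) where

  -- The first argument is what follows the last element.
  nextOr : A → List A → A → A
  nextOr d []          v = d
  nextOr d (x ∷ [])    v = d
  nextOr d (x ∷ y ∷ l) v = if does (v ≟ x) then y else nextOr d (y ∷ l) v

  next : List A → A → A
  next []      v = v
  next (x ∷ l) v = nextOr x (x ∷ l) v

  nextOr-Adj : ∀ {d l x y} → Unique l → Adj l x y → nextOr d l x ≡ y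
  nextOr-Adj {x = x} u here with x ≟ x
  ... | yes _ = refl
  ... | no x≢x = contradiction refl x≢x
  nextOr-Adj {l = z ∷ w ∷ l} {x} (z∉ ∷ u) (there q) with x ≟ z
  ... | yes refl = ⊥-elim (All.lookup z∉ (Adj-∈ˡ q) refl)
  ... | no _ = nextOr-Adj u q

  nextOr-Last : ∀ {d l x} → Unique l → Last l x → nextOr d l x ≡ d
  nextOr-Last u last = refl
  nextOr-Last {l = z ∷ w ∷ l} {x} (z∉ ∷ u) (there q) with x ≟ z
  ... | yes refl = ⊥-elim (All.lookup z∉ (Last-∈ q) refl)
  ... | no _ = nextOr-Last u q

  next-CAdj : ∀ {l x y} → Unique l → CAdj l x y → next l x ≡ y
  next-CAdj {_ ∷ _} u (inj₁ q)           = nextOr-Adj u q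
  next-CAdj         u (inj₂ (q , first)) = nextOr-Last u q

  -- On the elements of `l`, `next` for the reversed list is a left inverse.
  next-injective : ∀ {l x y} → Unique l → x ∈ l → y ∈ l → next l x ≡ next l y → x ≡ y
  next-injective {l} {x} {y} u x∈ y∈ eq with successor x∈ | successor y∈
  ... | x′ , p | y′ , q = trans (sym (back p)) (trans (cong (next (reverse l)) eq′) (back q))
    where
    u′ : Unique (reverse l)
    u′ = Unique-resp-↭ (↭-sym (Perm.↭-reverse l)) u
    back : ∀ {a b} → CAdj l a b → next (reverse l) b ≡ a
    back a = next-CAdj u′ (CAdj-reverse a)
    eq′ : x′ ≡ y′
    eq′ = trans (sym (next-CAdj u p)) (trans eq (next-CAdj u q))

-- Counting along the orbits of a permutation

unique-↭ : ∀ {A : Set} {xs ys : List A} → Unique xs → Unique ys →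
           (∀ {x} → x ∈ xs → x ∈ ys) → (∀ {x} → x ∈ ys → x ∈ xs) → xs ↭ ys
unique-↭ u v f g = ∼bag⇒↭ (unique∧set⇒bag u v (mk⇔ f g))

map-unique : ∀ {A B : Set} (f : A → B) {xs} → (∀ {x y} → x ∈ xs → y ∈ xs → f x ≡ f y → x ≡ y) →
             Unique xs → Unique (map f xs)
map-unique f inj []       = []
map-unique f inj (x∉ ∷ u) =
  All.map⁺ (All.tabulate (λ y∈ eq → All.lookup x∉ y∈ (inj (here refl) (there y∈) eq)))
  ∷ map-unique f (λ x∈ y∈ → inj (there x∈) (there y∈)) u

bit : Bool → ℕ
bit b = if b then 1 else 0

count : ∀ {A : Set} → (A → Bool) → List A → ℕ
count χ xs = sum (map (bit ∘ χ) xs)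

length-filterᵇ : ∀ {A : Set} (χ : A → Bool) xs → length (filterᵇ χ xs) ≡ count χ xs
length-filterᵇ χ []       = refl
length-filterᵇ χ (x ∷ xs) with χ x
... | true  = cong suc (length-filterᵇ χ xs)
... | false = length-filterᵇ χ xs

count-↭ : ∀ {A : Set} (χ : A → Bool) {xs ys} → xs ↭ ys → count χ xs ≡ count χ ys
count-↭ χ q = sum-↭ (Perm.map⁺ (bit ∘ χ) q)

sum-map-+ : ∀ {A : Set} (g h : A → ℕ) xs →
            sum (map (λ x → g x + h x) xs) ≡ sum (map g xs) + sum (map h xs)
sum-map-+ g h []       = refl
sum-map-+ g h (x ∷ xs) = trans (cong ((g x + h x) +_) (sum-map-+ g h xs))
                               (interchange (g x) (h x) _ _)

sum-map-≤ : ∀ {A : Set} (g : A → ℕ) xs → (∀ {x} → x ∈ xs → g x ≤ 1) → sum (map g xs) ≤ length xs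
sum-map-≤ g []       q = z≤n
sum-map-≤ g (x ∷ xs) q = +-mono-≤ (q (here refl)) (sum-map-≤ g xs (q ∘ there))

sum-map-≥ : ∀ {A : Set} (g : A → ℕ) xs → (∀ {x} → x ∈ xs → 1 ≤ g x) → length xs ≤ sum (map g xs)
sum-map-≥ g []       q = z≤n
sum-map-≥ g (x ∷ xs) q = +-mono-≤ (q (here refl)) (sum-map-≥ g xs (q ∘ there))

hits : ∀ {A : Set} → (A → A) → (A → Bool) → ℕ → A → ℕ
hits f χ zero    x = 0
hits f χ (suc n) x = bit (χ (iter f n x)) + hits f χ n x

module _ {A : Set} (f : A → A) (χ : A → Bool) where

  map-iter-↭ : ∀ {xs} → map f xs ↭ xs → ∀ n → map (iter f n) xs ↭ xs
  map-iter-↭ {xs} q zero    = subst (_↭ xs) (sym (map-id xs)) ↭-refl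
  map-iter-↭ {xs} q (suc n) =
    ↭-trans (subst (_↭ map f xs) (sym (map-∘ xs)) (Perm.map⁺ f (map-iter-↭ q n))) q

  -- Double counting: for each fixed `i < n` the map `iter f i` permutes `xs`, so the `i`-th
  -- iterates contribute `count χ xs` in total.
  sum-hits : ∀ {xs} → map f xs ↭ xs → ∀ n → sum (map (hits f χ n) xs) ≡ n * count χ xs
  sum-hits {[]}     q zero = refl
  sum-hits {x ∷ xs} q zero = zeros xs
    where
    zeros : ∀ (xs : List A) → sum (map (λ _ → 0) xs) ≡ 0
    zeros []       = refl
    zeros (_ ∷ xs) = zeros xs
  sum-hits {xs} q (suc n) = begin
    sum (map (λ x → bit (χ (iter f n x)) + hits f χ n x) xs)
      ≡⟨ sum-map-+ (bit ∘ χ ∘ iter f n) (hits f χ n) xs ⟩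
    sum (map (bit ∘ χ ∘ iter f n) xs) + sum (map (hits f χ n) xs)
      ≡⟨ cong₂ _+_ (cong sum (map-∘ xs)) (sum-hits q n) ⟩
    count χ (map (iter f n) xs) + n * count χ xs
      ≡⟨ cong (_+ n * count χ xs) (count-↭ χ (map-iter-↭ q n)) ⟩
    count χ xs + n * count χ xs ∎
    where open ≡-Reasoning

  hits-none : ∀ n x → (∀ {i} → i < n → χ (iter f i x) ≢ true) → hits f χ n x ≡ 0
  hits-none zero    x q = refl
  hits-none (suc n) x q with χ (iter f n x) in eq
  ... | true  = ⊥-elim (q ≤-refl eq)
  ... | false = hits-none n x (λ i< → q (m≤n⇒m≤1+n i<))

  hits-≤1 : ∀ n x → (∀ {i j} → i < j → j < n → χ (iter f i x) ≡ true → χ (iter f j x) ≢ true) →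
            hits f χ n x ≤ 1
  hits-≤1 zero    x q = z≤n
  hits-≤1 (suc n) x q with χ (iter f n x) in eq
  ... | true  = ≤-reflexive (cong suc (hits-none n x (λ i< c → q i< ≤-refl c eq)))
  ... | false = hits-≤1 n x (λ i<j j< → q i<j (m≤n⇒m≤1+n j<))

  hits-≥1 : ∀ {n m} x → m < n → χ (iter f m x) ≡ true → 1 ≤ hits f χ n x
  hits-≥1 {suc n} {m} x (s≤s m≤n) c with m≤n⇒m<n∨m≡n m≤n
  ... | inj₁ m<n  = ≤-trans (hits-≥1 x m<n c) (m≤n+m _ _)
  ... | inj₂ refl rewrite c = s≤s z≤n

  iter-% : ∀ {N x} .{{_ : NonZero N}} → iter f N x ≡ x → ∀ k → iter f k x ≡ iter f (k % N) x
  iter-% {N} {x} ret k = begin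
    iter f k x                                 ≡⟨ cong (λ n → iter f n x) (m≡m%n+[m/n]*n k N) ⟩
    iter f (k % N + (k / N) * N) x             ≡⟨ iter-+ f (k % N) _ x ⟩
    iter f (k % N) (iter f ((k / N) * N) x)    ≡⟨ cong (iter f (k % N)) (multiple (k / N)) ⟩
    iter f (k % N) x                           ∎
    where
    open ≡-Reasoning
    multiple : ∀ j → iter f (j * N) x ≡ x
    multiple zero    = refl
    multiple (suc j) = trans (iter-+ f N (j * N) x) (trans (cong (iter f N) (multiple j)) ret)

argmin : (g : ℕ → ℕ) → ∀ n → ∃ λ m → m < suc n × (∀ {k} → k < suc n → g m ≤ g k)
argmin g zero = 0 , s≤s z≤n , λ { {zero} _ → ≤-refl ; {suc k} (s≤s ()) }
argmin g (suc n) with argmin g n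
... | m , m< , min with ≤-total (g m) (g (suc n))
...   | inj₁ le = m , m≤n⇒m≤1+n m< , λ k< → lemma (m<1+n⇒m<n∨m≡n k<)
  where
  lemma : ∀ {k} → k < suc n ⊎ k ≡ suc n → g m ≤ g k
  lemma (inj₁ k<)   = min k<
  lemma (inj₂ refl) = le
...   | inj₂ ge = suc n , ≤-refl , λ k< → lemma (m<1+n⇒m<n∨m≡n k<)
  where
  lemma : ∀ {k} → k < suc n ⊎ k ≡ suc n → g (suc n) ≤ g k
  lemma (inj₁ k<)   = ≤-trans ge (min k<)
  lemma (inj₂ refl) = ≤-refl

-- The darts of the complete graph

IsDart : ∀ {p} → Dart p → Set
IsDart (u , v) = u ≢ v

dartIndex-injective : ∀ {p} {d e : Dart p} → dartIndex d ≡ dartIndex e → d ≡ e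
dartIndex-injective {p} {u , v} {u′ , v′} eq
  with Fin.combine-injective u v u′ v′ (Fin.toℕ-injective (trans (index u v) (trans eq (sym (index u′ v′)))))
  where
  index : ∀ (u v : Fin p) → toℕ (combine u v) ≡ toℕ u * p + toℕ v
  index u v = trans (Fin.toℕ-combine u v) (cong (_+ toℕ v) (*-comm p (toℕ u)))
... | refl , refl = refl

allPairs : ∀ p → List (Dart p)
allPairs p = cartesianProduct (allFin p) (allFin p)

concatMap-pairs : ∀ {A B : Set} (xs : List A) (ys : List B) →
                  concatMap (λ x → map (x ,_) ys) xs ≡ cartesianProduct xs ys
concatMap-pairs []       ys = refl
concatMap-pairs (x ∷ xs) ys = cong (map (x ,_) ys ++_) (concatMap-pairs xs ys)

module _ (p : ℕ) where

  private
    test : Dart p → Bool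
    test d = not ⌊ proj₁ d Fin.≟ proj₂ d ⌋

  darts≡ : darts p ≡ filterᵇ test (allPairs p)
  darts≡ = cong (filterᵇ test) (concatMap-pairs (allFin p) (allFin p))

  ∈-allPairs : ∀ (d : Dart p) → d ∈ allPairs p
  ∈-allPairs (u , v) = ∈-cartesianProduct⁺ (∈-allFin u) (∈-allFin v)

  allPairs-unique : Unique (allPairs p)
  allPairs-unique = Unique.cartesianProduct⁺ (Unique.allFin⁺ p) (Unique.allFin⁺ p)

  darts-unique : Unique (darts p)
  darts-unique rewrite darts≡ = Unique.filter⁺ (Bool.T? ∘ test) allPairs-unique

  ∈-darts⁺ : ∀ {d} → IsDart d → d ∈ darts p
  ∈-darts⁺ {d} nd rewrite darts≡ = ∈-filter⁺ (Bool.T? ∘ test) (∈-allPairs d) (holds nd)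
    where
    holds : IsDart d → T (test d)
    holds nd with proj₁ d Fin.≟ proj₂ d
    ... | yes eq = ⊥-elim (nd eq)
    ... | no _   = tt

  ∈-darts⁻ : ∀ {d} → d ∈ darts p → IsDart d
  ∈-darts⁻ {d} d∈ rewrite darts≡ = holds (proj₂ (∈-filter⁻ (Bool.T? ∘ test) {xs = allPairs p} d∈))
    where
    holds : T (test d) → IsDart d
    holds t with proj₁ d Fin.≟ proj₂ d
    ... | no ¬eq = ¬eq

  allPairs↭ : allPairs p ↭ darts p ++ map (λ u → u , u) (allFin p)
  allPairs↭ = unique-↭ allPairs-unique
    (Unique.++⁺ darts-unique (Unique.map⁺ (cong proj₁) (Unique.allFin⁺ p)) disjoint)
    (λ {d} _ → covers d) (λ {d} _ → ∈-allPairs d)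
    where
    disjoint : ∀ {d} → ¬ (d ∈ darts p × d ∈ map (λ u → u , u) (allFin p))
    disjoint (d∈ , q) with ∈-map⁻ (λ u → u , u) q
    ... | _ , _ , refl = ∈-darts⁻ d∈ refl
    covers : ∀ d → d ∈ darts p ++ map (λ u → u , u) (allFin p)
    covers (u , v) with u Fin.≟ v
    ... | yes refl = ∈-++⁺ʳ (darts p) (∈-map⁺ (λ u → u , u) (∈-allFin u))
    ... | no u≢v   = ∈-++⁺ˡ (∈-darts⁺ u≢v)

  length-darts : length (darts p) + p ≡ p * p
  length-darts = begin
    length (darts p) + p
      ≡⟨ cong (length (darts p) +_) (sym (trans (length-map _ (allFin p)) (length-tabulate id))) ⟩
    length (darts p) + length (map (λ u → u , u) (allFin p))
      ≡⟨ sym (length-++ (darts p)) ⟩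
    length (darts p ++ map (λ u → u , u) (allFin p))
      ≡⟨ sym (Perm.↭-length allPairs↭) ⟩
    length (allPairs p)
      ≡⟨ lengths (allFin p) ⟩
    length (allFin p) * p
      ≡⟨ cong (_* p) (length-tabulate {n = p} id) ⟩
    p * p ∎
    where
    open ≡-Reasoning
    lengths : ∀ (xs : List (Fin p)) → length (cartesianProduct xs (allFin p)) ≡ length xs * p
    lengths []       = refl
    lengths (x ∷ xs) = trans (length-++ (map (x ,_) (allFin p)))
      (cong₂ _+_ (trans (length-map _ (allFin p)) (length-tabulate id)) (lengths xs))

-- Counting the faces of a rotation system

module Orbits {p : ℕ} (R : Rotation p) where

  f : Dart p → Dart p
  f = faceStep R

  f-dart : ∀ {d} → IsDart d → IsDart (f d)
  f-dart {u , v} u≢v eq = avoid R v u u≢v (sym eq)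

  iter-dart : ∀ n {d} → IsDart d → IsDart (iter f n d)
  iter-dart zero    q = q
  iter-dart (suc n) q = f-dart (iter-dart n q)

  f-injective : ∀ {d e} → IsDart d → IsDart e → f d ≡ f e → d ≡ e
  f-injective {u , v} {u′ , v′} d e eq with ,-injective eq
  ... | refl , eq′ = cong (_, v) (inj R v u u′ d e eq′)

  iter-injective : ∀ n {d e} → IsDart d → IsDart e → iter f n d ≡ iter f n e → d ≡ e
  iter-injective zero    qd qe eq = eq
  iter-injective (suc n) qd qe eq =
    iter-injective n qd qe (f-injective (iter-dart n qd) (iter-dart n qe) eq)

  -- Among `p * p + 1` iterates two coincide, and cancelling the common part gives a return.
  -- Cancellation is available on darts only, since `Rotation` constrains `σ u` only away from `u`.
  -- The bound matches the range tested by `isFaceRep`, so the test decides minimality over the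
  -- whole orbit.
  period : ∀ {d} → IsDart d → ∃ λ N → 0 < N × N ≤ p * p × iter f N d ≡ d
  period {d} qd
    with Fin.pigeonhole (n<1+n (p * p)) (λ i → combine (proj₁ (iter f (toℕ i) d)) (proj₂ (iter f (toℕ i) d)))
  ... | i , j , i<j , eq = toℕ j ∸ toℕ i , m<n⇒0<n∸m i<j
      , ≤-trans (m∸n≤m (toℕ j) (toℕ i)) (≤-pred (Fin.toℕ<n j))
      , sym (iter-injective (toℕ i) qd (iter-dart (toℕ j ∸ toℕ i) qd) same)
    where
    same : iter f (toℕ i) d ≡ iter f (toℕ i) (iter f (toℕ j ∸ toℕ i) d)
    same with Fin.combine-injective _ _ _ _ eq
    ... | e₁ , e₂ = trans (cong₂ _,_ e₁ e₂)
      (trans (cong (λ n → iter f n d) (sym (m+[n∸m]≡n (<⇒≤ i<j)))) (iter-+ f (toℕ i) _ d))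

  rep : Dart p → Bool
  rep = isFaceRep R

  rep-minimal : ∀ {d} → IsDart d → rep d ≡ true → ∀ k → dartIndex d ≤ dartIndex (iter f k d)
  rep-minimal {d} qd r k with period qd
  ... | N@(suc _) , _ , N≤ , ret =
    subst (λ e → dartIndex d ≤ dartIndex e) (sym (iter-% f rep ret k))
      (≤ᵇ⇒≤ _ _ (All.lookup (All.all⁺ _ (upTo (p * p)) (subst T (sym r) tt))
                  (∈-upTo⁺ (<-≤-trans (m%n<n k N) N≤))))

  minimal-rep : ∀ {d} → (∀ k → dartIndex d ≤ dartIndex (iter f k d)) → rep d ≡ true
  minimal-rep {d} q = T⇒≡ (All.all⁻ _ (All.tabulate {xs = upTo (p * p)} (λ {k} _ → ≤⇒≤ᵇ (q k))))
    where
    T⇒≡ : ∀ {b} → T b → b ≡ true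
    T⇒≡ {true} _ = refl

  -- On a cycle of length `N`, going back `k` steps is going forward `k N - k` steps.
  iter-back : ∀ {d} → IsDart d → ∀ i j → i ≤ j → ∃ λ m → iter f i d ≡ iter f m (iter f j d)
  iter-back {d} qd i j i≤j with period (iter-dart i qd)
  ... | N , 0<N , _ , ret = m , sym (begin
      iter f m (iter f j d)                       ≡⟨ cong (λ n → iter f m (iter f n d)) (sym (m∸n+n≡m i≤j)) ⟩
      iter f m (iter f (k + i) d)                 ≡⟨ cong (iter f m) (iter-+ f k i d) ⟩
      iter f m (iter f k (iter f i d))            ≡⟨ sym (iter-+ f m k _) ⟩
      iter f (m + k) (iter f i d)                 ≡⟨ cong (λ n → iter f n (iter f i d)) (m∸n+n≡m k≤) ⟩
      iter f (k * N) (iter f i d)                 ≡⟨ multiple k ⟩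
      iter f i d                                  ∎)
    where
    open ≡-Reasoning
    k = j ∸ i
    m = k * N ∸ k
    k≤ : k ≤ k * N
    k≤ = m≤m*n k N {{>-nonZero 0<N}}
    multiple : ∀ n → iter f (n * N) (iter f i d) ≡ iter f i d
    multiple zero    = refl
    multiple (suc n) = trans (iter-+ f N (n * N) _) (trans (cong (iter f N) (multiple n)) ret)

  -- Two representatives on one orbit both have the least index there, so they coincide; lying fewer
  -- than `n` steps apart, they would give an early return.
  hits-rep-≤1 : ∀ {d} n → IsDart d →
                (∀ i {k} → 0 < k → k < n → iter f k (iter f i d) ≢ iter f i d) → hits f rep n d ≤ 1
  hits-rep-≤1 {d} n qd noRet = hits-≤1 f rep n d clash
    where
    clash : ∀ {i j} → i < j → j < n → rep (iter f i d) ≡ true → rep (iter f j d) ≢ true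
    clash {i} {j} i<j j<n ri rj with iter-back qd i j (<⇒≤ i<j)
    ... | m , eq = noRet i (m<n⇒0<n∸m i<j) (≤-<-trans (m∸n≤m j i) j<n) (trans (sym split) (sym same))
      where
      split : iter f j d ≡ iter f (j ∸ i) (iter f i d)
      split = trans (cong (λ n → iter f n d) (sym (m∸n+n≡m (<⇒≤ i<j)))) (iter-+ f (j ∸ i) i d)
      same : iter f i d ≡ iter f j d
      same = dartIndex-injective (≤-antisym
        (subst (λ e → dartIndex (iter f i d) ≤ dartIndex e) (sym split) (rep-minimal (iter-dart i qd) ri (j ∸ i)))
        (subst (λ e → dartIndex (iter f j d) ≤ dartIndex e) (sym eq) (rep-minimal (iter-dart j qd) rj m)))

  hits-rep-≥1 : ∀ {d} N → 0 < N → iter f N d ≡ d → 1 ≤ hits f rep N d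
  hits-rep-≥1 {d} N@(suc n) 0<N ret with argmin (λ k → dartIndex (iter f k d)) n
  ... | m , m< , min = hits-≥1 f rep d m< (minimal-rep λ k →
    subst (λ e → dartIndex (iter f m d) ≤ dartIndex e)
      (trans (sym (iter-% f rep ret (k + m))) (iter-+ f k m d)) (min (m%n<n (k + m) N)))

  iter-closed : ∀ {xs} → (∀ {d} → d ∈ xs → f d ∈ xs) → ∀ n {d} → d ∈ xs → iter f n d ∈ xs
  iter-closed cl zero    d∈ = d∈
  iter-closed cl (suc n) d∈ = cl (iter-closed cl n d∈)

  closed-↭ : ∀ {xs} → Unique xs → (∀ {d} → d ∈ xs → IsDart d) → (∀ {d} → d ∈ xs → f d ∈ xs) →
             map f xs ↭ xs
  closed-↭ {xs} u qd cl = unique-↭ (map-unique f (λ x∈ y∈ → f-injective (qd x∈) (qd y∈)) u) u into onto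
    where
    into : ∀ {d} → d ∈ map f xs → d ∈ xs
    into d∈ with ∈-map⁻ f d∈
    ... | _ , e∈ , refl = cl e∈
    onto : ∀ {d} → d ∈ xs → d ∈ map f xs
    onto {d} d∈ with period (qd d∈)
    ... | suc n , _ , _ , ret = subst (_∈ map f xs) ret (∈-map⁺ f (iter-closed cl n d∈))

  numFaces≡count : numFaces R ≡ count rep (darts p)
  numFaces≡count = length-filterᵇ rep (darts p)

  numFaces-upper : FacesAtLeast 4 R → 4 * numFaces R ≤ length (darts p)
  numFaces-upper big = begin
    4 * numFaces R                        ≡⟨ cong (4 *_) numFaces≡count ⟩
    4 * count rep (darts p)               ≡⟨ sum-hits f rep perm 4 ⟨
    sum (map (hits f rep 4) (darts p))    ≤⟨ sum-map-≤ _ (darts p) (λ d∈ → hits-rep-≤1 4 (∈-darts⁻ p d∈)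
                                               (λ i 0<k k<4 → big _ _ (iter-dart i (∈-darts⁻ p d∈)) _ 0<k k<4)) ⟩
    length (darts p)                      ∎
    where
    open ≤-Reasoning
    perm : map f (darts p) ↭ darts p
    perm = closed-↭ (darts-unique p) (∈-darts⁻ p) (λ d∈ → ∈-darts⁺ p (f-dart (∈-darts⁻ p d∈)))

  count-rep : ∀ {xs} N → 0 < N → Unique xs → (∀ {d} → d ∈ xs → IsDart d) → (∀ {d} → d ∈ xs → f d ∈ xs) →
              (∀ {d} → d ∈ xs → iter f N d ≡ d) →
              (∀ {d} → d ∈ xs → ∀ {k} → 0 < k → k < N → iter f k d ≢ d) →
              N * count rep xs ≡ length xs
  count-rep {xs} N 0<N u qd cl ret noRet = trans (sym (sum-hits f rep (closed-↭ u qd cl) N)) (≤-antisym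
    (sum-map-≤ _ xs (λ d∈ → hits-rep-≤1 N (qd d∈) (λ i → noRet (iter-closed cl i d∈))))
    (sum-map-≥ _ xs (λ d∈ → hits-rep-≥1 N 0<N (ret d∈))))

  -- The hypotheses make `S` a single orbit, so it holds one representative; all other darts have
  -- period exactly four. Hence there are `length S + 4 (F - 1)` darts.
  numFaces-exact : ∀ {S N} → length S ≡ suc N → Unique S → (∀ {d} → d ∈ S → IsDart d) →
                   (∀ {d} → d ∈ S → f d ∈ S) →
                   (∀ {d} → d ∈ S → iter f (suc N) d ≡ d) →
                   (∀ {d} → d ∈ S → ∀ {k} → 0 < k → k < suc N → iter f k d ≢ d) →
                   (∀ {d} → IsDart d → d ∉ S → iter f 4 d ≡ d) →
                   FacesAtLeast 4 R →
                   4 * numFaces R + suc N ≡ length (darts p) + 4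
  numFaces-exact {S} {N} len u qd cl ret noRet quads big = begin
    4 * numFaces R + suc N
      ≡⟨ cong (λ n → 4 * n + suc N) (trans numFaces≡count (count-↭ rep split)) ⟩
    4 * count rep (S ++ rest) + suc N            ≡⟨ cong (λ n → 4 * n + suc N) (count-++ S) ⟩
    4 * (count rep S + count rep rest) + suc N   ≡⟨ cong (λ n → 4 * (n + count rep rest) + suc N) one ⟩
    4 * (1 + count rep rest) + suc N             ≡⟨ arith (count rep rest) (suc N) ⟩
    suc N + 4 * count rep rest + 4               ≡⟨ cong₂ (λ m n → m + n + 4) (sym len) fours ⟩
    length S + length rest + 4                   ≡⟨ cong (_+ 4) (sym (trans (Perm.↭-length split) (length-++ S))) ⟩
    length (darts p) + 4                         ∎
    where
    open ≡-Reasoning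
    arith : ∀ c n → 4 * (1 + c) + n ≡ n + 4 * c + 4
    arith = solve-∀
    open DecMembership (≡-dec (Fin._≟_ {p}) (Fin._≟_ {p})) using (_∈?_)
    outside = λ d → ¬? (d ∈? S)
    rest = filter outside (darts p)
    split : darts p ↭ S ++ rest
    split = unique-↭ (darts-unique p)
      (Unique.++⁺ u (Unique.filter⁺ outside (darts-unique p))
        (λ { (d∈S , d∈) → proj₂ (∈-filter⁻ outside {xs = darts p} d∈) d∈S }))
      cover back
      where
      cover : ∀ {d} → d ∈ darts p → d ∈ S ++ rest
      cover {d} d∈ with d ∈? S
      ... | yes d∈S = ∈-++⁺ˡ d∈S
      ... | no d∉S  = ∈-++⁺ʳ S (∈-filter⁺ outside d∈ d∉S)
      back : ∀ {d} → d ∈ S ++ rest → d ∈ darts p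
      back d∈ with ∈-++⁻ S d∈
      ... | inj₁ d∈S = ∈-darts⁺ p (qd d∈S)
      ... | inj₂ d∈r = proj₁ (∈-filter⁻ outside {xs = darts p} d∈r)
    count-++ : ∀ (xs : List (Dart p)) {ys} → count rep (xs ++ ys) ≡ count rep xs + count rep ys
    count-++ []            = refl
    count-++ (x ∷ xs) {ys} = trans (cong (bit (rep x) +_) (count-++ xs)) (sym (+-assoc (bit (rep x)) _ _))
    one : count rep S ≡ 1
    one = *-cancelˡ-≡ _ _ (suc N)
      (trans (count-rep (suc N) (s≤s z≤n) u qd cl ret noRet) (trans len (sym (*-identityʳ (suc N)))))
    rest-dart : ∀ {d} → d ∈ rest → IsDart d
    rest-dart d∈ = ∈-darts⁻ p (proj₁ (∈-filter⁻ outside {xs = darts p} d∈))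
    rest-out : ∀ {d} → d ∈ rest → d ∉ S
    rest-out d∈ = proj₂ (∈-filter⁻ outside {xs = darts p} d∈)
    fours : 4 * count rep rest ≡ length rest
    fours = count-rep 4 (s≤s z≤n) (Unique.filter⁺ outside (darts-unique p)) rest-dart
      (λ {d} d∈ → ∈-filter⁺ outside (∈-darts⁺ p (f-dart (rest-dart d∈)))
        -- If `f d` were in `S`, three more steps would stay in `S` and lead back to `d`.
        (λ fd∈S → rest-out d∈ (subst (_∈ S) (quads (rest-dart d∈) (rest-out d∈)) (iter-closed cl 3 fd∈S))))
      (λ d∈ → quads (rest-dart d∈) (rest-out d∈))
      (λ d∈ 0<k k<4 → big _ _ (rest-dart d∈) _ 0<k k<4)

-- Embeddings as signed cyclic neighbour lists

orient : {A : Set} → Bool → (A → A → Set) → A → A → Set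
orient true  R x y = R x y
orient false R x y = R y x

orient-true : ∀ {A : Set} {b R} {x y : A} → b ≡ true → R x y → orient b R x y
orient-true refl q = q

orient-false : ∀ {A : Set} {b R} {x y : A} → b ≡ false → R y x → orient b R x y
orient-false refl q = q

orient-map : ∀ {A B : Set} {R : A → A → Set} {R′ : B → B → Set} (g : A → B) →
             (∀ {x y} → R x y → R′ (g x) (g y)) →
             ∀ b {x y} → orient b R x y → orient b R′ (g x) (g y)
orient-map g h true  = h
orient-map g h false = h

-- Step x y z is to be read as: z follows y in the rotation at x.
record Quad {V : Set} (Step : V → V → V → Set) (u v : V) : Set where
  constructor mkQuad
  field
    {w t}  : V
    turn-v : Step v u w
    turn-w : Step w v t
    turn-t : Step t w u
    turn-u : Step u t v

-- The rotation at u is the cyclic list nbrs u, read backwards if sign u is false.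
module Steps {V : Set} (sign : V → Bool) (nbrs : V → List V) where

  CStep : V → V → V → Set
  CStep u = orient (sign u) (CAdj (nbrs u))

record Map (V : Set) : Set where
  field
    sign : V → Bool
    nbrs : V → List V
  open Steps sign nbrs public
  field
    unique       : ∀ u → Unique (nbrs u)
    complete     : ∀ {u v} → v ≢ u → v ∈ nbrs u
    proper       : ∀ {u} → u ∉ nbrs u
    special      : List (V × V)
    special!     : Unique special
    special-step : ∀ {d e} → CAdj special d e →
                   proj₂ d ≡ proj₁ e × CStep (proj₁ e) (proj₁ d) (proj₂ e)
    faces        : ∀ {u v} → u ≢ v → Quad CStep u v ⊎ (u , v) ∈ special

module _ {A B : Set} (g : A → B) where

  Adj-map : ∀ {l x y} → Adj l x y → Adj (map g l) (g x) (g y)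
  Adj-map here      = here
  Adj-map (there q) = there (Adj-map q)

  First-map : ∀ {l x} → First l x → First (map g l) (g x)
  First-map first = first

  Last-map : ∀ {l x} → Last l x → Last (map g l) (g x)
  Last-map last      = last
  Last-map (there q) = there (Last-map q)

  CAdj-map : ∀ {l x y} → CAdj l x y → CAdj (map g l) (g x) (g y)
  CAdj-map = Sum.map Adj-map (Product.map Last-map First-map)

  Adj-map⁻ : ∀ l {x y} → Adj (map g l) x y → ∃₂ λ a b → Adj l a b × g a ≡ x × g b ≡ y
  Adj-map⁻ (a ∷ b ∷ l) here      = a , b , here , refl , refl
  Adj-map⁻ (c ∷ l)     (there q) with Adj-map⁻ l q
  ... | a , b , q′ , ea , eb = a , b , there q′ , ea , eb

  Last-map⁻ : ∀ l {x} → Last (map g l) x → ∃ λ a → Last l a × g a ≡ x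
  Last-map⁻ (a ∷ [])    last      = a , last , refl
  Last-map⁻ (a ∷ [])    (there ())
  Last-map⁻ (c ∷ d ∷ l) (there q) with Last-map⁻ (d ∷ l) q
  ... | a , q′ , eq = a , there q′ , eq

  CAdj-map⁻ : ∀ l {x y} → CAdj (map g l) x y → ∃₂ λ a b → CAdj l a b × g a ≡ x × g b ≡ y
  CAdj-map⁻ l       (inj₁ q) with Adj-map⁻ l q
  ... | a , b , q′ , ea , eb = a , b , inj₁ q′ , ea , eb
  CAdj-map⁻ (c ∷ l) (inj₂ (q , first)) with Last-map⁻ (c ∷ l) q
  ... | a , q′ , eq = a , c , inj₂ (q′ , first) , eq , refl

module Transport {V W : Set} (iso : V ↔ W) (M : Map V) where
  open Map M
  open Inverse iso

  relabel : Map W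
  relabel = record
    { sign         = sign′
    ; nbrs         = nbrs′
    ; unique       = λ u → Unique.map⁺ to-injective (unique (from u))
    ; complete     = λ {u} {v} v≢u → subst (_∈ nbrs′ u) (strictlyInverseˡ v)
                       (∈-map⁺ to (complete (λ eq → v≢u (from-injective eq))))
    ; proper       = λ {u} u∈ → improper (∈-map⁻ to u∈)
    ; special      = map pair special
    ; special!     = Unique.map⁺
        (λ eq → cong₂ _,_ (to-injective (cong proj₁ eq)) (to-injective (cong proj₂ eq)))
        special!
    ; special-step = step′
    ; faces        = λ {u} {v} u≢v → subst₂ (λ u v → Quad CStep′ u v ⊎ (u , v) ∈ map pair special)
                       (strictlyInverseˡ u) (strictlyInverseˡ v)
                       (Sum.map quad (∈-map⁺ pair) (faces (λ eq → u≢v (from-injective eq))))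
    }
    where
    sign′ = sign ∘ from
    nbrs′ = map to ∘ nbrs ∘ from
    pair : V × V → W × W
    pair (u , v) = to u , to v
    open Steps sign′ nbrs′ renaming (CStep to CStep′)
    to-injective : ∀ {x y} → to x ≡ to y → x ≡ y
    to-injective {x} {y} eq = trans (sym (strictlyInverseʳ x)) (trans (cong from eq) (strictlyInverseʳ y))
    from-injective : ∀ {x y} → from x ≡ from y → x ≡ y
    from-injective {x} {y} eq = trans (sym (strictlyInverseˡ x)) (trans (cong to eq) (strictlyInverseˡ y))
    improper : ∀ {u} → ¬ (∃ λ v → v ∈ nbrs (from u) × u ≡ to v)
    improper {u} (v , v∈ , refl) = proper (subst (v ∈_) (cong nbrs (strictlyInverseʳ v)) v∈)
    cstep : ∀ u {x y} → CStep u x y → CStep′ (to u) (to x) (to y)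
    cstep u q rewrite strictlyInverseʳ u = orient-map to (CAdj-map to) (sign u) q
    quad : ∀ {u v} → Quad CStep u v → Quad CStep′ (to u) (to v)
    quad {u} {v} (mkQuad {w} {t} q₁ q₂ q₃ q₄) =
      mkQuad (cstep v q₁) (cstep w q₂) (cstep t q₃) (cstep u q₄)
    step′ : ∀ {d e} → CAdj (map pair special) d e →
            proj₂ d ≡ proj₁ e × CStep′ (proj₁ e) (proj₁ d) (proj₂ e)
    step′ q with CAdj-map⁻ pair special q
    ... | a , b , q′ , refl , refl with special-step q′
    ...   | eq , q″ = cong to eq , cstep (proj₁ b) q″

-- From signed lists to rotation systems

third : ∀ {n} (u v : Fin (3 + n)) → ∃ λ x → x ≢ u × x ≢ v
third zero          zero          = suc zero , (λ ()) , (λ ())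
third zero          (suc zero)    = suc (suc zero) , (λ ()) , (λ ())
third zero          (suc (suc _)) = suc zero , (λ ()) , (λ ())
third (suc zero)    zero          = suc (suc zero) , (λ ()) , (λ ())
third (suc (suc _)) zero          = suc zero , (λ ()) , (λ ())
third (suc _)       (suc _)       = zero , (λ ()) , (λ ())

module FromLists {p : ℕ} (rotated : Fin p → List (Fin p)) (rotated! : ∀ u → Unique (rotated u))
                 (rotated-∈⁺ : ∀ {u v} → v ≢ u → v ∈ rotated u)
                 (rotated-∈⁻ : ∀ {u v} → v ∈ rotated u → v ≢ u) where
  open Next (Fin._≟_ {p})

  next-∈ : ∀ {l x} → Unique l → x ∈ l → next l x ∈ l
  next-∈ {l} u x∈ with successor x∈
  ... | y , q = subst (_∈ l) (sym (next-CAdj u q)) (CAdj-∈ʳ q)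

  rotation : Rotation p
  rotation = record
    { σ     = λ u v → next (rotated u) v
    ; avoid = λ u v v≢u → rotated-∈⁻ (next-∈ (rotated! u) (rotated-∈⁺ v≢u))
    ; inj   = λ u v w v≢u w≢u → next-injective (rotated! u) (rotated-∈⁺ v≢u) (rotated-∈⁺ w≢u)
    ; cyc   = λ u v w v≢u w≢u →
        Cycle.cycle-reach (next (rotated u)) (next-CAdj (rotated! u)) (rotated-∈⁺ v≢u) (rotated-∈⁺ w≢u)
    }

  σ-next : ∀ {u x y} → CAdj (rotated u) x y → σ rotation u x ≡ y
  σ-next {u} q = next-CAdj (rotated! u) q

module Realize {n : ℕ} (M : Map (Fin (3 + n))) where
  open Map M

  private
    p = 3 + n

  rotated : Fin p → List (Fin p)
  rotated u = if sign u then nbrs u else reverse (nbrs u)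

  rotated! : ∀ u → Unique (rotated u)
  rotated! u with sign u
  ... | true  = unique u
  ... | false = Unique-resp-↭ (↭-sym (Perm.↭-reverse _)) (unique u)

  rotated-∈⁺ : ∀ {u v} → v ≢ u → v ∈ rotated u
  rotated-∈⁺ {u} v≢u with sign u
  ... | true  = complete v≢u
  ... | false = Perm.∈-resp-↭ (↭-sym (Perm.↭-reverse _)) (complete v≢u)

  rotated-∈⁻ : ∀ {u v} → v ∈ rotated u → v ≢ u
  rotated-∈⁻ {u} v∈ refl with sign u
  ... | true  = proper v∈
  ... | false = proper (Perm.∈-resp-↭ (Perm.↭-reverse _) v∈)

  CStep-rotated : ∀ {u x y} → CStep u x y → CAdj (rotated u) x y
  CStep-rotated {u} q with sign u
  ... | true  = q
  ... | false = CAdj-reverse q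

  open FromLists rotated rotated! rotated-∈⁺ rotated-∈⁻ public

  σ-step : ∀ {u x y} → CStep u x y → σ rotation u x ≡ y
  σ-step {u} q = σ-next (CStep-rotated q)

  open Orbits rotation

  f-special : ∀ {d e} → CAdj special d e → f d ≡ e
  f-special q with special-step q
  ... | refl , s = cong (_ ,_) (σ-step s)

  special-dart : ∀ {d} → d ∈ special → IsDart d
  special-dart {u , v} d∈ refl with successor d∈
  ... | (_ , z) , q with special-step q
  ...   | refl , s = rotated-∈⁻ (CAdj-∈ˡ (CStep-rotated s)) refl

  open Cycle f

  special-closed : ∀ {d} → d ∈ special → f d ∈ special
  special-closed d∈ with successor d∈
  ... | e , q = subst (_∈ special) (sym (f-special q)) (CAdj-∈ʳ q)

  quad-return : ∀ {u v} → Quad CStep u v → iter f 4 (u , v) ≡ (u , v)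
  quad-return (mkQuad q₁ q₂ q₃ q₄)
    rewrite σ-step q₁ | σ-step q₂ | σ-step q₃ | σ-step q₄ = refl

  -- A fixed neighbour would be a cycle of its own, against `cyc`, because a third vertex exists.
  -- This rules out faces of length 2.
  σ-moves : ∀ {u v} → v ≢ u → σ rotation u v ≢ v
  σ-moves {u} {v} v≢u eq with third u v
  ... | x , x≢u , x≢v with cyc rotation u v x v≢u x≢u
  ...   | k , reach = x≢v (trans (sym reach) (fixed k))
    where
    fixed : ∀ k → iter (σ rotation u) k v ≡ v
    fixed zero    = refl
    fixed (suc k) = trans (cong (σ rotation u) (fixed k)) eq

  f-moves : ∀ {d} → IsDart d → f d ≢ d
  f-moves u≢v eq = u≢v (sym (cong proj₁ eq))

  f²-moves : ∀ {d} → IsDart d → f (f d) ≢ d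
  f²-moves {u , v} u≢v eq =
    σ-moves u≢v (cong proj₁ eq)

  facesAtLeast : 4 ≤ length special → FacesAtLeast 4 rotation
  facesAtLeast 4≤ u v u≢v k 1≤k k<4 eq with faces u≢v
  ... | inj₂ d∈ = cycle-noReturn f-special special! d∈ 1≤k (<-≤-trans k<4 4≤) eq
  facesAtLeast 4≤ u v u≢v 1 _ _ eq | inj₁ q = f-moves u≢v eq
  facesAtLeast 4≤ u v u≢v 2 _ _ eq | inj₁ q = f²-moves u≢v eq
  -- If both three and four steps return, then so does a single one.
  facesAtLeast 4≤ u v u≢v 3 _ _ eq | inj₁ q =
    f-moves u≢v (trans (sym (cong f eq)) (quad-return q))
  facesAtLeast 4≤ u v u≢v (suc (suc (suc (suc _)))) _ (s≤s (s≤s (s≤s (s≤s ())))) eq | inj₁ q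

  numFaces-special : ∀ {e} → length special ≡ 4 + e → 4 * numFaces rotation + e + p ≡ p * p
  numFaces-special {e} len = begin
    4 * numFaces rotation + e + p
      ≡⟨ cong (_+ p) (+-cancelʳ-≡ 4 (4 * numFaces rotation + e) (length (darts p)) (trans (shuffle _ e) exact)) ⟩
    length (darts p) + p            ≡⟨ length-darts p ⟩
    p * p                           ∎
    where
    open ≡-Reasoning
    shuffle : ∀ m e → m + e + 4 ≡ m + (4 + e)
    shuffle m e = trans (+-assoc m e 4) (cong (m +_) (+-comm e 4))
    ordinary : ∀ {d} → IsDart d → d ∉ special → iter f 4 d ≡ d
    ordinary u≢v d∉ with faces u≢v
    ... | inj₁ q  = quad-return q
    ... | inj₂ d∈ = ⊥-elim (d∉ d∈)
    exact : 4 * numFaces rotation + (4 + e) ≡ length (darts p) + 4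
    exact = numFaces-exact len special! special-dart special-closed
      (λ {d} d∈ → subst (λ n → iter f n d ≡ d) len (cycle-return f-special d∈))
      (λ d∈ 0<k k< → cycle-noReturn f-special special! d∈ 0<k (subst (_ <_) (sym len) k<))
      ordinary
      (facesAtLeast (subst (4 ≤_) (sym len) (m≤m+n 4 e)))

-- Layouts with open corners, and gadgets

-- Says where new vertices enter a neighbour list: behind it, in front of it, or split between both
-- ends.
data Kind : Set where
  generic distinguished extra : Kind

flat : {V : Set} → List (V × V) → List V
flat []            = []
flat ((x , y) ∷ q) = x ∷ y ∷ flat q

-- The darts of a quadrilateral `l x f y`. The same four also describe a face between two
-- consecutive new vertices, so it is not built in that `f` and `l` are first and last neighbours.
data WrapDart {V : Set} (x y f l : V) : V → V → Set where
  l→x : WrapDart x y f l l x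
  x→f : WrapDart x y f l x f
  f→y : WrapDart x y f l f y
  y→l : WrapDart x y f l y l

module InnerSteps {V : Set} (sign : V → Bool) (nbrs : V → List V) where

  -- Insertions happen only at the ends of a list, so a step of this kind persists in all later
  -- layouts.
  Step : V → V → V → Set
  Step u = orient (sign u) (Adj (nbrs u))

rotate : ∀ {V : Set} {Step : V → V → V → Set} {u v} (q : Quad Step u v) → Quad Step v (Quad.w q)
rotate (mkQuad p q r s) = mkQuad q r s p

-- The corner between the last and the first neighbour in nbrs u is the one into which new vertices are inserted; it
-- is excluded by Step.  It lies on the quadrilateral of the pair of u, or, for the unpaired vertex r, on that of the
-- distinguished pair (a , b).  In the order seen by the new vertices, pairs comes first (starting with (i , i′)),
-- then (a , b), then the place of the gadget, then (c , c′).
record Layout (V : Set) : Set where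
  field
    sign    : V → Bool
    nbrs    : V → List V
    kind    : V → Kind
    special : List (V × V)
    pairs   : List (V × V)
    i i′ a b c c′ r : V

-- h tells whether there is an unpaired vertex, that is, whether the order is odd.
module LayoutProperties (h : Bool) {V : Set} (lay : Layout V) where
  open Layout lay public
  open InnerSteps sign nbrs public

  apex : List V
  apex = if h then [ r ] else []

  frame : List V
  frame = flat pairs ++ a ∷ b ∷ c ∷ c′ ∷ apex

  -- x and y are opposite on the quadrilateral l x f y, whose corners at x and y are the open ones.
  record Pair (κ : Kind) (x y f l : V) : Set where
    field
      kind-x  : kind x ≡ κ
      kind-y  : kind y ≡ κ
      sign-x  : sign x ≡ true
      sign-y  : sign y ≡ false
      first-x : First (nbrs x) f
      first-y : First (nbrs y) f
      last-x  : Last (nbrs x) l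
      last-y  : Last (nbrs y) l
      turn-l  : Step l y x

  GenericPair : V → V → Set
  GenericPair x y = ∃₂ λ f l → Pair generic x y f l × Step f x y

  -- The turn at `r` on the quadrilateral `l a r b`. An unpaired `r` is itself open there, between
  -- its last neighbour `a` and its first neighbour `b`; otherwise the turn is an inner one, like
  -- the turn at `f` in `GenericPair`.
  ApexTurn : Set
  ApexTurn = if h then kind r ≡ extra × First (nbrs r) b × Last (nbrs r) a else Adj (nbrs r) a b

  -- The third case collects the quadrilaterals that the next insertion cuts up; they are the only
  -- faces through an open corner.
  data Cover (u v : V) : Set where
    onQuad    : Quad Step u v → Cover u v
    onSpecial : (u , v) ∈ special → Cover u v
    onWrap    : ∀ {x y f l} → (x , y) ∈ (a , b) ∷ (c , c′) ∷ pairs →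
                First (nbrs x) f → Last (nbrs x) l → WrapDart x y f l u v → Cover u v

record State (h : Bool) (V : Set) : Set where
  field
    layout : Layout V
  open LayoutProperties h layout public
  field
    frame!    : Unique frame
    frame-∋   : ∀ u → u ∈ frame
    nbrs↭     : ∀ u → u ∷ nbrs u ↭ frame
    head      : First pairs (i , i′)
    generics  : ∀ {x y} → (x , y) ∈ (c , c′) ∷ pairs → GenericPair x y
    dist      : ∃ λ l → Pair distinguished a b r l
    sign-r    : sign r ≡ true
    turn-r    : ApexTurn
    special!  : Unique special
    special-step : ∀ {d e} → CAdj special d e → proj₂ d ≡ proj₁ e × Step (proj₁ e) (proj₁ d) (proj₂ e)
    cover     : ∀ {u v} → u ≢ v → Cover u v

-- The vertices seen by the gadget: α, β, γ, ρ stand for a, b, c, r.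
data Loc : Set where
  new     : Fin 8 → Loc
  α β γ ρ : Loc

block : List (Fin 8)
block = 0F ∷ 1F ∷ 2F ∷ 3F ∷ 4F ∷ 5F ∷ 6F ∷ 7F ∷ []

even : Fin 8 → Bool
even 0F = true
even 1F = false
even 2F = true
even 3F = false
even 4F = true
even 5F = false
even 6F = true
even 7F = false

newKind : Fin 8 → Kind
newKind 2F = distinguished
newKind 3F = distinguished
newKind _  = generic

locSign : Loc → Bool
locSign (new k) = even k
locSign α       = true
locSign β       = false
locSign γ       = true
locSign ρ       = true

-- At a new vertex k, tl k and then hd k come between a and c; the new distinguished pair (2 , 3) has its open corner
-- between tl and hd, on the quadrilateral q 2 r′ 3.  Between a and b, the vertex r receives rowA and then rowB.
record Table : Set where
  field
    hd tl     : Fin 8 → List Loc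
    rowA rowB : List (Fin 8)
    r′ q      : Loc

module TableProperties (h : Bool) (table : Table) where
  open Table table public

  apexˡ : List Loc
  apexˡ = if h then [ ρ ] else []

  -- The parts of the new neighbour lists that are relevant to the gadget.
  newSegs : Kind → Fin 8 → List (List Loc)
  newSegs distinguished k = (hd k ++ [ γ ]) ∷ (α ∷ tl k) ∷ []
  newSegs _             k = (α ∷ tl k ++ hd k ++ [ γ ]) ∷ []

  segs : Loc → List (List Loc)
  segs (new k) = newSegs (newKind k) k
  segs α = (map new block ++ [ ρ ]) ∷ []
  segs β = (map new block ++ [ ρ ]) ∷ []
  segs γ = map new block ∷ []
  segs ρ = if h then (α ∷ map new rowA) ∷ (map new rowB ++ [ β ]) ∷ [] else (α ∷ β ∷ []) ∷ []

  LStep : Loc → Loc → Loc → Set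
  LStep u = orient (locSign u) (λ x y → Any (λ seg → Adj seg x y) (segs u))

  LCover : Loc → Loc → Set
  LCover u v = Quad LStep u v ⊎ WrapDart (new 2F) (new 3F) r′ q u v

-- The `cover` fields deal with the darts among new vertices, with those to and from an unpaired
-- `r`, and with the darts of the faces that the insertion leaves to the gadget: `j c k b` for the
-- couples `0 1`, `2 3`, `4 5`, `6 7`, and `7 a r b`.
record Gadget (h : Bool) : Set where
  field
    table : Table
  open TableProperties h table public
  field
    content  : ∀ k → new k ∷ tl k ++ hd k ↭ β ∷ map new block ++ apexˡ
    rows     : rowB ++ rowA ↭ block
    tl-β     : ∀ k → k ≢ 7F → First (tl k) β
    hd-2     : First (hd 2F) r′
    hd-3     : First (hd 3F) r′
    tl-2     : Last (tl 2F) q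
    tl-3     : Last (tl 3F) q
    turn-q   : LStep q (new 3F) (new 2F)
    apex-r′  : if h then r′ ≡ ρ × First rowB 3F × Last rowA 2F
               else LStep r′ (new 2F) (new 3F) × ∃ λ k → r′ ≡ new k × even k ≡ true
    cover-new : ∀ {j k} → j ≢ k → LCover (new j) (new k)
    cover-ρ   : h ≡ true → ∀ k → LCover (new k) ρ × LCover ρ (new k)
    cover-even : ∀ k → even k ≡ true → LCover (new k) γ × LCover β (new k)
    cover-odd  : ∀ k → even k ≡ false → LCover γ (new k) × LCover (new k) β
    cover-7α  : LCover (new 7F) α
    cover-αρ  : LCover α ρ
    cover-ρβ  : LCover ρ β
    cover-β7  : LCover β (new 7F)

-- Parity among the new vertices and neighbours in the chain of pairs

-- Within a pair `x`, `y` the faces `j x k y` have `j` odd and `k` its even successor. This leaves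
-- out `0F` and `7F`, which lie next to the old neighbours on the two sides of the corner that
-- receives the block.
before-even : ∀ k → even k ≡ true → k ≡ 0F ⊎ ∃ λ j → even j ≡ false × Adj block j k × j ≢ 7F
before-even 0F _ = inj₁ refl
before-even 2F _ = inj₂ (1F , refl , there here , λ ())
before-even 4F _ = inj₂ (3F , refl , there (there (there here)) , λ ())
before-even 6F _ = inj₂ (5F , refl , there (there (there (there (there here)))) , λ ())
before-even 7F ()

after-odd : ∀ k → even k ≡ false → k ≡ 7F ⊎ ∃ λ j → even j ≡ true × Adj block k j × k ≢ 7F
after-odd 1F _ = inj₂ (2F , refl , there here , λ ())
after-odd 3F _ = inj₂ (4F , refl , there (there (there here)) , λ ())
after-odd 5F _ = inj₂ (6F , refl , there (there (there (there (there here)))) , λ ())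
after-odd 7F _ = inj₁ refl

-- Between the second vertex of one pair and the first vertex of the next, parities are exchanged: a
-- face joins an even new vertex and its odd successor, and no new vertex is left out. These couples
-- are also the new pairs.
data Twins : Fin 8 → Fin 8 → Set where
  twins₀ : Twins 0F 1F
  twins₂ : Twins 2F 3F
  twins₄ : Twins 4F 5F
  twins₆ : Twins 6F 7F

after-even : ∀ k → even k ≡ true → ∃ λ j → Twins k j
after-even 0F _ = 1F , twins₀
after-even 2F _ = 3F , twins₂
after-even 4F _ = 5F , twins₄
after-even 6F _ = 7F , twins₆
after-even 7F ()

before-odd : ∀ k → even k ≡ false → ∃ λ j → Twins j k
before-odd 1F _ = 0F , twins₀
before-odd 3F _ = 2F , twins₂
before-odd 5F _ = 4F , twins₄
before-odd 7F _ = 6F , twins₆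

twins-adj : ∀ {j k} → Twins j k → Adj block j k
twins-adj twins₀ = here
twins-adj twins₂ = there (there here)
twins-adj twins₄ = there (there (there (there here)))
twins-adj twins₆ = there (there (there (there (there (there here)))))

twins-even : ∀ {j k} → Twins j k → even j ≡ true × even k ≡ false
twins-even twins₀ = refl , refl
twins-even twins₂ = refl , refl
twins-even twins₄ = refl , refl
twins-even twins₆ = refl , refl

module _ {A : Set} where

  Adj-prefix : ∀ {l m : List A} {x y z} → Adj (l ++ [ x ]) y z → First m x → Adj (l ++ m) y z
  Adj-prefix {_ ∷ []}    here      first = here
  Adj-prefix {_ ∷ _ ∷ _} here      first = here
  Adj-prefix {[]}        (there ()) _
  Adj-prefix {_ ∷ []}    (there (there ())) _
  Adj-prefix {_ ∷ _ ∷ _} (there q) p     = there (Adj-prefix q p)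

  Adj-suffix : ∀ {l m : List A} {x y z} → Adj (x ∷ l) y z → Last m x → Adj (m ++ l) y z
  Adj-suffix here      last = here
  Adj-suffix (there q) last = there q
  Adj-suffix q (there p) = there (Adj-suffix q p)

  First-chain : ∀ {q : List (A × A)} {x y} l → First q (x , y) → First (flat q ++ l) x
  First-chain l first = first

  pair-adj : ∀ {q : List (A × A)} {x y} l → (x , y) ∈ q → Adj (flat q ++ l) x y
  pair-adj l (here refl) = here
  pair-adj l (there p)   = there (there (pair-adj l p))

  previous : ∀ {q : List (A × A)} {x y h} l → First q h → (x , y) ∈ q →
             x ≡ proj₁ h ⊎ ∃₂ λ x₀ y₀ → (x₀ , y₀) ∈ q × Adj (flat q ++ l) y₀ x
  previous l first (here refl) = inj₁ refl
  previous {h ∷ k ∷ q} l first (there p) with previous l first p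
  ... | inj₁ refl                = inj₂ (_ , _ , here refl , there here)
  ... | inj₂ (x₀ , y₀ , m , adj) = inj₂ (x₀ , y₀ , there m , there (there adj))

  following : ∀ {q : List (A × A)} {x y a} → (x , y) ∈ q →
              ∃ λ x₁ → (x₁ ≡ a ⊎ ∃ λ y₁ → (x₁ , y₁) ∈ q) × Adj (flat q ++ [ a ]) y x₁
  following {(_ ∷ [])}         (here refl) = _ , inj₁ refl , there here
  following {(_ ∷ (z , w) ∷ q)} (here refl) = z , inj₂ (w , there (here refl)) , there here
  following {_ ∷ q}            (there p) with following p
  ... | x₁ , inj₁ e       , adj = x₁ , inj₁ e , there (there adj)
  ... | x₁ , inj₂ (y₁ , m) , adj = x₁ , inj₂ (y₁ , there m) , there (there adj)

  final : ∀ {q : List (A × A)} {h a} → First q h →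
          ∃₂ λ x₀ y₀ → (x₀ , y₀) ∈ q × Adj (flat q ++ [ a ]) y₀ a
  final {(x , y) ∷ []}    first = x , y , here refl , there here
  final {_ ∷ _ ∷ _}       first with final first
  ... | x₀ , y₀ , m , adj = x₀ , y₀ , there m , there (there adj)

  flat-++ : ∀ (p q : List (A × A)) → flat (p ++ q) ≡ flat p ++ flat q
  flat-++ []            q = refl
  flat-++ ((x , y) ∷ p) q = cong (λ l → x ∷ y ∷ l) (flat-++ p q)

  flat-∈ : ∀ {q : List (A × A)} {u} → u ∈ flat q → ∃₂ λ x y → (x , y) ∈ q × (u ≡ x ⊎ u ≡ y)
  flat-∈ {(x , y) ∷ q} (here refl)         = x , y , here refl , inj₁ refl
  flat-∈ {(x , y) ∷ q} (there (here refl)) = x , y , here refl , inj₂ refl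
  flat-∈ {(x , y) ∷ q} (there (there p)) with flat-∈ p
  ... | x′ , y′ , m , e = x′ , y′ , there m , e

flat-map : ∀ {A B : Set} (g : A → B) q → flat (map (Product.map g g) q) ≡ map g (flat q)
flat-map g []            = refl
flat-map g ((x , y) ∷ q) = cong (λ l → g x ∷ g y ∷ l) (flat-map g q)

Adj-cong : ∀ {A : Set} {l m : List A} {x y} → l ≡ m → Adj l x y → Adj m x y
Adj-cong refl q = q

First-unique : ∀ {A : Set} {l : List A} {x y} → First l x → First l y → x ≡ y
First-unique first first = refl

Last-unique : ∀ {A : Set} {l : List A} {x y} → Last l x → Last l y → x ≡ y
Last-unique last      last      = refl
Last-unique (there p) (there q) = Last-unique p q

ifT : ∀ {A B : Set} b → (if b then A else B) → (b ≡ true × A) ⊎ (b ≡ false × B)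
ifT true  q = inj₁ (refl , q)
ifT false q = inj₂ (refl , q)

ifI : ∀ {A B : Set} b → (b ≡ true → A) → (b ≡ false → B) → if b then A else B
ifI true  f g = f refl
ifI false f g = g refl

any-if : ∀ {A : Set} {P : A → Set} b {xs ys : List A} → Any P (if b then xs else ys) →
         (b ≡ true × Any P xs) ⊎ (b ≡ false × Any P ys)
any-if true  q = inj₁ (refl , q)
any-if false q = inj₂ (refl , q)

map-if : ∀ {A B : Set} (g : A → B) b {x : A} → map g (if b then [ x ] else []) ≡ (if b then [ g x ] else [])
map-if g true  = refl
map-if g false = refl

true≢false : ∀ {b} → b ≡ true → b ≢ false
true≢false refl ()

-- Inserting eight vertices

module Extend {h : Bool} {V : Set} (st : State h V) (gadget : Gadget h) where

  open State st
  open Gadget gadget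

  V′ : Set
  V′ = Fin 8 ⊎ V

  -- Not injective in general: for even order `r` is a paired vertex and may be `c`. Steps and lists
  -- are only pushed forward along this map.
  η : Loc → V′
  η (new k) = inj₁ k
  η α       = inj₂ a
  η β       = inj₂ b
  η γ       = inj₂ c
  η ρ       = inj₂ r

  old² : V × V → V′ × V′
  old² = Product.map inj₂ inj₂

  block′ : List V′
  block′ = map inj₁ block

  -- The block now separates the cut of `(a , b)` from `r`, and later blocks go behind the lists of
  -- `a` and `b`, as for every other pair. An unpaired `r` keeps its kind.
  demote : Kind → Kind
  demote extra = extra
  demote _     = generic

  sign′ : V′ → Bool
  sign′ (inj₁ k) = even k
  sign′ (inj₂ u) = sign u

  kind′ : V′ → Kind
  kind′ (inj₁ k) = newKind k
  kind′ (inj₂ u) = demote (kind u)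

  grow : Kind → List V → List V′
  grow generic       l = map inj₂ l ++ block′
  grow distinguished l = block′ ++ map inj₂ l
  grow extra         l = map inj₁ rowB ++ map inj₂ l ++ map inj₁ rowA

  -- One cyclic pattern cut at two places: after `c′` for a generic new vertex, between `tl k` and
  -- `hd k` for `2F` and `3F`.
  arrange : Kind → Fin 8 → List V′
  arrange distinguished k = map η (hd k ++ [ γ ]) ++ inj₂ c′ ∷ map inj₂ (flat pairs) ++ map η (α ∷ tl k)
  arrange _             k = map inj₂ (flat pairs) ++ map η (α ∷ tl k ++ hd k ++ [ γ ]) ++ [ inj₂ c′ ]

  nbrs′ : V′ → List V′
  nbrs′ (inj₁ k) = arrange (newKind k) k
  nbrs′ (inj₂ u) = grow (kind u) (nbrs u)

  pairs′ : List (V′ × V′)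
  pairs′ = map old² pairs ++ (inj₂ a , inj₂ b) ∷ (inj₁ 0F , inj₁ 1F) ∷ (inj₁ 4F , inj₁ 5F) ∷ (inj₁ 6F , inj₁ 7F) ∷ []

  layout′ : Layout V′
  layout′ = record
    { sign = sign′ ; nbrs = nbrs′ ; kind = kind′ ; special = map old² special ; pairs = pairs′
    ; i = inj₂ i ; i′ = inj₂ i′ ; a = inj₁ 2F ; b = inj₁ 3F ; c = inj₂ c ; c′ = inj₂ c′ ; r = η r′ }

  open LayoutProperties h layout′ using ()
    renaming (Step to Step′; Cover to Cover′; Pair to Pair′; GenericPair to GenericPair′;
              onQuad to onQuad′; onSpecial to onSpecial′; onWrap to onWrap′;
              frame to frame′; apex to apex′; ApexTurn to ApexTurn′)

  even≢7 : ∀ {k} → even k ≡ true → k ≢ 7F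
  even≢7 () refl

  grow-adj : ∀ κ {l x y} → Adj l x y → Adj (grow κ l) (inj₂ x) (inj₂ y)
  grow-adj generic       q = Adj-++ˡ (Adj-map inj₂ q)
  grow-adj distinguished q = Adj-++ʳ block′ (Adj-map inj₂ q)
  grow-adj extra         q = Adj-++ʳ (map inj₁ rowB) (Adj-++ˡ (Adj-map inj₂ q))

  old-step : ∀ {u x y} → Step u x y → Step′ (inj₂ u) (inj₂ x) (inj₂ y)
  old-step {u} = orient-map inj₂ (grow-adj (kind u)) (sign u)

  old-quad : ∀ {u v} → Quad Step u v → Quad Step′ (inj₂ u) (inj₂ v)
  old-quad (mkQuad p q r s) = mkQuad (old-step p) (old-step q) (old-step r) (old-step s)

  block-adj′ : ∀ {u} → kind u ≢ extra → ∀ {x y} → Adj block′ x y → Adj (nbrs′ (inj₂ u)) x y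
  block-adj′ {u} ¬e q with kind u
  ... | generic       = Adj-++ʳ (map inj₂ (nbrs u)) q
  ... | distinguished = Adj-++ˡ q
  ... | extra         = ⊥-elim (¬e refl)

  block-adj : ∀ {u} → kind u ≢ extra → ∀ {j k} → Adj block j k → Adj (nbrs′ (inj₂ u)) (inj₁ j) (inj₁ k)
  block-adj {u} ¬e q = block-adj′ ¬e (Adj-map inj₁ q)
  generic≢extra : ∀ {u} → kind u ≡ generic → kind u ≢ extra
  generic≢extra e e′ with trans (sym e) e′
  ... | ()

  dist≢extra : ∀ {u} → kind u ≡ distinguished → kind u ≢ extra
  dist≢extra e e′ with trans (sym e) e′
  ... | ()

  nbrs-generic : ∀ {u} → kind u ≡ generic → nbrs′ (inj₂ u) ≡ map inj₂ (nbrs u) ++ block′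
  nbrs-generic {u} e = cong (λ κ → grow κ (nbrs u)) e

  nbrs-dist : ∀ {u} → kind u ≡ distinguished → nbrs′ (inj₂ u) ≡ block′ ++ map inj₂ (nbrs u)
  nbrs-dist {u} e = cong (λ κ → grow κ (nbrs u)) e

  l₀ : V
  l₀ = proj₁ dist

  module D = Pair (proj₂ dist)

  chain-adj : ∀ k {x y} → Adj (flat pairs ++ [ a ]) x y → Adj (nbrs′ (inj₁ k)) (inj₂ x) (inj₂ y)
  chain-adj k q with newKind k
  ... | distinguished = Adj-++ʳ (map η (hd k ++ [ γ ]))
    (there (Adj-prefix (Adj-cong (map-++ inj₂ (flat pairs) [ a ]) (Adj-map inj₂ q)) first))
  ... | generic = Adj-prefix (Adj-cong (map-++ inj₂ (flat pairs) [ a ]) (Adj-map inj₂ q)) first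
  ... | extra   = Adj-prefix (Adj-cong (map-++ inj₂ (flat pairs) [ a ]) (Adj-map inj₂ q)) first

  cc′-adj : ∀ k → Adj (nbrs′ (inj₁ k)) (inj₂ c) (inj₂ c′)
  cc′-adj k with newKind k
  ... | distinguished = Adj-join (Last-map η (Last-++ (hd k) last)) first
  ... | generic = Adj-++ʳ (map inj₂ (flat pairs))
    (Adj-join (Last-map η (Last-++ (α ∷ tl k) (Last-++ (hd k) last))) first)
  ... | extra   = Adj-++ʳ (map inj₂ (flat pairs))
    (Adj-join (Last-map η (Last-++ (α ∷ tl k) (Last-++ (hd k) last))) first)

  -- At `7F` the corner between `a` and `b` lies on `7 a r b`, which the gadget may fill, so other
  -- vertices can come between them there.
  ab-adj : ∀ k → k ≢ 7F → Adj (nbrs′ (inj₁ k)) (inj₂ a) (inj₂ b)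
  ab-adj k k≢7 with newKind k
  ... | distinguished = Adj-++ʳ (map η (hd k ++ [ γ ])) (there (Adj-++ʳ (map inj₂ (flat pairs))
                          (Adj-map η (Adj-join {l = [ α ]} last (tl-β k k≢7)))))
  ... | generic = Adj-++ʳ (map inj₂ (flat pairs)) (Adj-++ˡ
                    (Adj-map η (Adj-join {l = [ α ]} last (First-++ (tl-β k k≢7)))))
  ... | extra   = Adj-++ʳ (map inj₂ (flat pairs)) (Adj-++ˡ
                    (Adj-map η (Adj-join {l = [ α ]} last (First-++ (tl-β k k≢7)))))

  pair-adj′ : ∀ k {x y} → (x , y) ∈ (c , c′) ∷ pairs → Adj (nbrs′ (inj₁ k)) (inj₂ x) (inj₂ y)
  pair-adj′ k (here refl) = cc′-adj k
  pair-adj′ k (there p)   = chain-adj k (pair-adj [ a ] p)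

  flat-first : First (map inj₂ (flat pairs)) (inj₂ {A = Fin 8} i)
  flat-first = subst (λ l → First l (inj₂ i)) (cong (map inj₂) (++-identityʳ (flat pairs)))
                 (First-map inj₂ (First-chain [] head))

  c′i-adj : ∀ k → newKind k ≡ distinguished → Adj (nbrs′ (inj₁ k)) (inj₂ c′) (inj₂ i)
  c′i-adj k e rewrite e = Adj-++ʳ (map η (hd k ++ [ γ ])) (Adj-join {l = [ inj₂ c′ ]} last
    (First-++ flat-first))

  head-∈ : (i , i′) ∈ pairs
  head-∈ = First-∈ head

  -- Apart from the gadget and the ends of the lists, every face with old and new vertices is of this form.
  turn-quad : ∀ {x y j k} → sign x ≡ true → sign y ≡ false → kind x ≢ extra → kind y ≢ extra → Adj block j k →
              Step′ (inj₁ k) (inj₂ x) (inj₂ y) → Step′ (inj₁ j) (inj₂ y) (inj₂ x) →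
              ∀ {u v} → WrapDart (inj₁ j) (inj₁ k) (inj₂ x) (inj₂ y) u v → Cover′ u v
  turn-quad {x} {y} {j} {k} sx sy kx ky jk k-turn j-turn = λ
    { l→x → onQuad′ (rotate (rotate (rotate base)))
    ; x→f → onQuad′ base
    ; f→y → onQuad′ (rotate base)
    ; y→l → onQuad′ (rotate (rotate base)) }
    where
    base : Quad Step′ (inj₁ j) (inj₂ x)
    base = mkQuad (orient-true sx (block-adj kx jk)) k-turn (orient-false sy (block-adj ky jk)) j-turn

  pair-kinds : ∀ {x y} → (x , y) ∈ (c , c′) ∷ pairs → kind x ≢ extra × kind y ≢ extra
  pair-kinds m with generics m
  ... | _ , _ , P , _ = generic≢extra (Pair.kind-x P) , generic≢extra (Pair.kind-y P)

  pair-signs : ∀ {x y} → (x , y) ∈ (c , c′) ∷ pairs → sign x ≡ true × sign y ≡ false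
  pair-signs m with generics m
  ... | _ , _ , P , _ = Pair.sign-x P , Pair.sign-y P

  pair-face : ∀ {x y j k} → (x , y) ∈ (c , c′) ∷ pairs → even j ≡ false → even k ≡ true → Adj block j k →
              ∀ {u v} → WrapDart (inj₁ j) (inj₁ k) (inj₂ x) (inj₂ y) u v → Cover′ u v
  pair-face {j = j} {k} m ej ek jk =
    turn-quad (proj₁ (pair-signs m)) (proj₂ (pair-signs m)) (proj₁ (pair-kinds m)) (proj₂ (pair-kinds m)) jk
      (orient-true ek (pair-adj′ k m)) (orient-false ej (pair-adj′ j m))

  ab-face : ∀ {j k} → even j ≡ false → even k ≡ true → Adj block j k → j ≢ 7F →
            ∀ {u v} → WrapDart (inj₁ j) (inj₁ k) (inj₂ a) (inj₂ b) u v → Cover′ u v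
  ab-face {j} {k} ej ek jk j≢7 =
    turn-quad D.sign-x D.sign-y (dist≢extra D.kind-x) (dist≢extra D.kind-y) jk
      (orient-true ek (ab-adj k (even≢7 ek))) (orient-false ej (ab-adj j j≢7))

  link-face : ∀ {x y j k} → sign x ≡ true → sign y ≡ false → kind x ≢ extra → kind y ≢ extra →
              Adj (flat pairs ++ [ a ]) y x → Twins j k →
              ∀ {u v} → WrapDart (inj₁ j) (inj₁ k) (inj₂ x) (inj₂ y) u v → Cover′ u v
  link-face {j = j} {k} sx sy kx ky yx t = turn-quad sx sy kx ky (twins-adj t)
    (orient-false (proj₂ (twins-even t)) (chain-adj k yx)) (orient-true (proj₁ (twins-even t)) (chain-adj j yx))

  η-sign : ∀ x → sign′ (η x) ≡ locSign x
  η-sign (new k) = refl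
  η-sign α       = D.sign-x
  η-sign β       = D.sign-y
  η-sign γ       = proj₁ (pair-signs (here refl))
  η-sign ρ       = sign-r

  arrange-adj : ∀ κ k {x y} → Any (λ seg → Adj seg x y) (newSegs κ k) → Adj (arrange κ k) (η x) (η y)
  arrange-adj generic       k (here q)         = Adj-++ʳ (map inj₂ (flat pairs)) (Adj-++ˡ (Adj-map η q))
  arrange-adj extra         k (here q)         = Adj-++ʳ (map inj₂ (flat pairs)) (Adj-++ˡ (Adj-map η q))
  arrange-adj distinguished k (here q)         = Adj-++ˡ (Adj-map η q)
  arrange-adj distinguished k (there (here q)) =
    Adj-++ʳ (map η (hd k ++ [ γ ])) (there (Adj-++ʳ (map inj₂ (flat pairs)) (Adj-map η q)))

  dist-adj : ∀ {u} → kind u ≡ distinguished → First (nbrs u) r → ∀ {x y} →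
             Adj (map new block ++ [ ρ ]) x y → Adj (nbrs′ (inj₂ u)) (η x) (η y)
  dist-adj e f q = Adj-cong (sym (nbrs-dist e)) (Adj-prefix {l = block′} (Adj-map η q) (First-map inj₂ f))

  seg-adj : ∀ x {y z} → Any (λ seg → Adj seg y z) (segs x) → Adj (nbrs′ (η x)) (η y) (η z)
  seg-adj (new k) q        = arrange-adj (newKind k) k q
  seg-adj α       (here q) = dist-adj D.kind-x D.first-x q
  seg-adj β       (here q) = dist-adj D.kind-y D.first-y q
  seg-adj γ       (here q) = block-adj′ (proj₁ (pair-kinds (here refl))) (Adj-map η q)
  seg-adj ρ       q with any-if h q | ifT h turn-r
  ... | inj₁ (ht , q′) | inj₂ (hf , _) = ⊥-elim (true≢false ht hf)
  ... | inj₂ (hf , q′) | inj₁ (ht , _) = ⊥-elim (true≢false ht hf)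
  ... | inj₂ (_ , here here) | inj₂ (_ , adj) = grow-adj (kind r) adj
  ... | inj₂ (_ , here (there (there ()))) | inj₂ (_ , adj)
  ... | inj₁ (_ , here q′) | inj₁ (_ , e , f , l) rewrite e =
    Adj-cong (++-assoc (map inj₁ rowB) (map inj₂ (nbrs r)) (map inj₁ rowA))
      (Adj-suffix (Adj-cong (cong (inj₂ a ∷_) (sym (map-∘ rowA))) (Adj-map η q′))
        (Last-++ (map inj₁ rowB) (Last-map inj₂ l)))
  ... | inj₁ (_ , there (here q′)) | inj₁ (_ , e , f , l) rewrite e =
    Adj-prefix {l = map inj₁ rowB}
      (Adj-cong (trans (map-++ η (map new rowB) [ β ]) (cong (_++ [ inj₂ b ]) (sym (map-∘ rowB)))) (Adj-map η q′))
      (First-++ (First-map inj₂ f))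

  -- The `segs` are pieces of the actual neighbour lists, so a face found among the twelve locations
  -- is a face for every `V`.
  local-step : ∀ u x y → LStep u x y → Step′ (η u) (η x) (η y)
  local-step u x y q = subst (λ s → orient s (Adj (nbrs′ (η u))) _ _) (sym (η-sign u))
                       (orient-map η (seg-adj u) (locSign u) q)

  special-step′ : ∀ {d e} → CAdj (map old² special) d e → proj₂ d ≡ proj₁ e × Step′ (proj₁ e) (proj₁ d) (proj₂ e)
  special-step′ q with CAdj-map⁻ old² special q
  ... | d , e , q′ , refl , refl with special-step q′
  ...   | eq , s = cong inj₂ eq , old-step s

  first-new : ∀ {k} → newKind k ≡ generic → First (nbrs′ (inj₁ k)) (inj₂ i)
  first-new e rewrite e = First-++ flat-first

  last-new : ∀ {k} → newKind k ≡ generic → Last (nbrs′ (inj₁ k)) (inj₂ c′)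
  last-new {k} e rewrite e = Last-++ (map inj₂ (flat pairs)) (Last-++ (map η (α ∷ tl k ++ hd k ++ [ γ ])) last)

  twins-generic : ∀ {j k} → Twins j k → newKind j ≡ generic → (inj₁ j , inj₁ k) ∈ pairs′
  twins-generic twins₀ _ = ∈-++⁺ʳ (map old² pairs) (there (here refl))
  twins-generic twins₄ _ = ∈-++⁺ʳ (map old² pairs) (there (there (here refl)))
  twins-generic twins₆ _ = ∈-++⁺ʳ (map old² pairs) (there (there (there (here refl))))

  i-sign : sign i ≡ true
  i-sign = proj₁ (pair-signs (there head-∈))

  c′-sign : sign c′ ≡ false
  c′-sign = proj₂ (pair-signs (here refl))

  i-kind : kind i ≢ extra
  i-kind = proj₁ (pair-kinds (there head-∈))

  c′-kind : kind c′ ≢ extra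
  c′-kind = proj₂ (pair-kinds (here refl))

  -- For three couples the corner from `c′` to `i` is the open one, and the face is the couple's own
  -- quadrilateral. At `2F` and `3F`, which are cut elsewhere, it is an inner face.
  ic′-face : ∀ {j k} → Twins j k → ∀ {u v} → WrapDart (inj₁ j) (inj₁ k) (inj₂ i) (inj₂ c′) u v → Cover′ u v
  ic′-face t@twins₀ = onWrap′ (there (there (twins-generic t refl))) (first-new {0F} refl) (last-new {0F} refl)
  ic′-face t@twins₄ = onWrap′ (there (there (twins-generic t refl))) (first-new {4F} refl) (last-new {4F} refl)
  ic′-face t@twins₆ = onWrap′ (there (there (twins-generic t refl))) (first-new {6F} refl) (last-new {6F} refl)
  ic′-face t@twins₂ = turn-quad i-sign c′-sign i-kind c′-kind (twins-adj t) (c′i-adj 3F refl) (c′i-adj 2F refl)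

  first-2 : First (nbrs′ (inj₁ 2F)) (η r′)
  first-2 = First-++ (First-map η (First-++ hd-2))

  last-2 : Last (nbrs′ (inj₁ 2F)) (η q)
  last-2 = Last-++ (map η (hd 2F ++ [ γ ])) (there (Last-++ (map inj₂ (flat pairs)) (there (Last-map η tl-2))))

  local : ∀ {u v} → LCover u v → Cover′ (η u) (η v)
  local {u} {v} (inj₁ (mkQuad {w} {t} p q r s)) = onQuad′ (mkQuad
    (local-step v u w p) (local-step w v t q) (local-step t w u r) (local-step u t v s))
  local (inj₂ l→x) = onWrap′ (here refl) first-2 last-2 l→x
  local (inj₂ x→f) = onWrap′ (here refl) first-2 last-2 x→f
  local (inj₂ f→y) = onWrap′ (here refl) first-2 last-2 f→y
  local (inj₂ y→l) = onWrap′ (here refl) first-2 last-2 y→l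

  dist′ : Pair′ distinguished (inj₁ 2F) (inj₁ 3F) (η r′) (η q)
  dist′ = record
    { kind-x = refl ; kind-y = refl ; sign-x = refl ; sign-y = refl
    ; first-x = first-2
    ; first-y = First-++ (First-map η (First-++ hd-3))
    ; last-x = last-2
    ; last-y = Last-++ (map η (hd 3F ++ [ γ ])) (there (Last-++ (map inj₂ (flat pairs)) (there (Last-map η tl-3))))
    ; turn-l = local-step q (new 3F) (new 2F) turn-q }

  -- The block lies between `l` and the cut, so the quadrilateral `l x f y` shrinks to `7 x f y`,
  -- again with open corners at `x` and `y`.
  old-pair : ∀ {x y f l} → (x , y) ∈ (c , c′) ∷ pairs → Pair generic x y f l →
             Pair′ generic (inj₂ x) (inj₂ y) (inj₂ f) (inj₁ 7F)
  old-pair {x} {y} {f} m P = record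
    { kind-x  = cong demote P.kind-x
    ; kind-y  = cong demote P.kind-y
    ; sign-x  = P.sign-x
    ; sign-y  = P.sign-y
    ; first-x = subst (λ l → First l (inj₂ f)) (sym (nbrs-generic P.kind-x)) (First-++ (First-map inj₂ P.first-x))
    ; first-y = subst (λ l → First l (inj₂ f)) (sym (nbrs-generic P.kind-y)) (First-++ (First-map inj₂ P.first-y))
    ; last-x  = subst (λ l → Last l (inj₁ 7F)) (sym (nbrs-generic P.kind-x)) (Last-++ (map inj₂ (nbrs x)) block-last)
    ; last-y  = subst (λ l → Last l (inj₁ 7F)) (sym (nbrs-generic P.kind-y)) (Last-++ (map inj₂ (nbrs y)) block-last)
    ; turn-l  = pair-adj′ 7F m
    }
    where
    module P = Pair P
    block-last : Last block′ (inj₁ 7F)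
    block-last = there (there (there (there (there (there (there last))))))

  old-generic : ∀ {x y} → (x , y) ∈ (c , c′) ∷ pairs → GenericPair′ (inj₂ x) (inj₂ y)
  old-generic m with generics m
  ... | f , l , P , turn-f = inj₂ f , inj₁ 7F , old-pair m P , old-step turn-f

  -- The block lies between the cut and `r`, so the pair's own quadrilateral becomes `l₀ a 0 b`; the
  -- other end piece, `7 a r b`, is left to the gadget.
  ab-generic : GenericPair′ (inj₂ a) (inj₂ b)
  ab-generic = inj₁ 0F , inj₂ l₀ , record
    { kind-x  = cong demote D.kind-x
    ; kind-y  = cong demote D.kind-y
    ; sign-x  = D.sign-x
    ; sign-y  = D.sign-y
    ; first-x = subst (λ l → First l (inj₁ 0F)) (sym (nbrs-dist D.kind-x)) first
    ; first-y = subst (λ l → First l (inj₁ 0F)) (sym (nbrs-dist D.kind-y)) first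
    ; last-x  = subst (λ l → Last l (inj₂ l₀)) (sym (nbrs-dist D.kind-x)) (Last-++ block′ (Last-map inj₂ D.last-x))
    ; last-y  = subst (λ l → Last l (inj₂ l₀)) (sym (nbrs-dist D.kind-y)) (Last-++ block′ (Last-map inj₂ D.last-y))
    ; turn-l  = old-step D.turn-l
    } , ab-adj 0F (λ ())

  twins-pair : ∀ {j k} → Twins j k → newKind j ≡ generic → newKind k ≡ generic → GenericPair′ (inj₁ j) (inj₁ k)
  twins-pair {j} {k} t ej ek = inj₂ i , inj₂ c′ , record
    { kind-x  = ej
    ; kind-y  = ek
    ; sign-x  = proj₁ (twins-even t)
    ; sign-y  = proj₂ (twins-even t)
    ; first-x = first-new ej
    ; first-y = first-new ek
    ; last-x  = last-new ej
    ; last-y  = last-new ek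
    ; turn-l  = orient-false c′-sign (block-adj c′-kind (twins-adj t))
    } , orient-true i-sign (block-adj i-kind (twins-adj t))

  generics′ : ∀ {x y} → (x , y) ∈ (inj₂ c , inj₂ c′) ∷ pairs′ → GenericPair′ x y
  generics′ (here refl) = old-generic (here refl)
  generics′ (there m) with ∈-++⁻ (map old² pairs) m
  ... | inj₂ (here refl)                         = ab-generic
  ... | inj₂ (there (here refl))                 = twins-pair twins₀ refl refl
  ... | inj₂ (there (there (here refl)))         = twins-pair twins₄ refl refl
  ... | inj₂ (there (there (there (here refl)))) = twins-pair twins₆ refl refl
  ... | inj₁ m′ with ∈-map⁻ old² m′
  ...   | _ , p∈ , refl = old-generic (there p∈)

  sign-r′ : sign′ (η r′) ≡ true
  sign-r′ with ifT h apex-r′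
  ... | inj₁ (_ , refl , _)          = sign-r
  ... | inj₂ (_ , _ , k , refl , ek) = ek

  -- For odd order the open corner of `r` moves between `2F`, the end of `rowA`, and `3F`, the start
  -- of `rowB`. For even order the role of `r` passes to an even new vertex.
  turn-r′ : ApexTurn′
  turn-r′ = ifI h odd-case even-case
    where
    odd-case : h ≡ true → kind′ (η r′) ≡ extra × First (nbrs′ (η r′)) (inj₁ 3F) × Last (nbrs′ (η r′)) (inj₁ 2F)
    odd-case ht with ifT h apex-r′ | ifT h turn-r
    ... | inj₂ (hf , _) | _ = ⊥-elim (true≢false ht hf)
    ... | _ | inj₂ (hf , _) = ⊥-elim (true≢false ht hf)
    ... | inj₁ (_ , refl , f , l) | inj₁ (_ , e , _) =
      cong demote e ,
      subst (λ l → First l (inj₁ 3F)) (sym grown) (First-++ (First-map inj₁ f)) ,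
      subst (λ l → Last l (inj₁ 2F)) (sym grown) (Last-++ (map inj₁ rowB) (Last-++ (map inj₂ (nbrs r)) (Last-map inj₁ l)))
      where
      grown : nbrs′ (inj₂ r) ≡ map inj₁ rowB ++ map inj₂ (nbrs r) ++ map inj₁ rowA
      grown = cong (λ κ → grow κ (nbrs r)) e
    even-case : h ≡ false → Adj (nbrs′ (η r′)) (inj₁ 2F) (inj₁ 3F)
    even-case hf with ifT h apex-r′
    ... | inj₁ (ht , _)         = ⊥-elim (true≢false ht hf)
    ... | inj₂ (_ , s , _) =
      subst (λ b → orient b (Adj (nbrs′ (η r′))) (inj₁ 2F) (inj₁ 3F)) sign-r′ (local-step r′ (new 2F) (new 3F) s)

  -- Every extended neighbour list is complete

  module CM = Algebra.Solver.CommutativeMonoid (Perm.++-commutativeMonoid {A = V′})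

  apexes : apex′ ≡ map inj₂ apex
  apexes with ifT h apex-r′
  ... | inj₁ (ht , refl , _) = sym (map-if inj₂ h)
  ... | inj₂ (hf , _) rewrite hf = refl

  η-apex : map η apexˡ ≡ map inj₂ apex
  η-apex = trans (map-if η h) (sym (map-if inj₂ h))

  F X : List V′
  F = map inj₂ (flat pairs)
  X = map inj₂ apex

  map-frame : map inj₂ frame ≡ F ++ inj₂ a ∷ inj₂ b ∷ inj₂ c ∷ inj₂ c′ ∷ X
  map-frame = map-++ inj₂ (flat pairs) _

  -- The order changes because `(2 , 3)` takes the place of `(a , b)`, which moves into `pairs′`
  -- together with the other new pairs.
  frame′↭ : frame′ ↭ map inj₂ frame ++ block′
  frame′↭ = begin
    frame′
      ≡⟨ cong₂ (λ l m → l ++ inj₁ 2F ∷ inj₁ 3F ∷ inj₂ c ∷ inj₂ c′ ∷ m)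
           (trans (flat-++ (map old² pairs) _) (cong (_++ A ++ B₁ ++ B₃) (flat-map inj₂ pairs))) apexes ⟩
    (F ++ A ++ B₁ ++ B₃) ++ B₂ ++ C ++ X
      ↭⟨ solve 7 (λ F A B₁ B₂ B₃ C X → (F ⊕ (A ⊕ (B₁ ⊕ B₃))) ⊕ (B₂ ⊕ (C ⊕ X)) ⊜ (F ⊕ (A ⊕ (C ⊕ X))) ⊕ (B₁ ⊕ (B₂ ⊕ B₃)))
           ↭-refl F A B₁ B₂ B₃ C X ⟩
    (F ++ A ++ C ++ X) ++ block′
      ≡⟨ cong (_++ block′) (sym map-frame) ⟩
    map inj₂ frame ++ block′ ∎
    where
    open PermutationReasoning
    open CM
    A B₁ B₂ B₃ C : List V′
    A  = inj₂ a ∷ inj₂ b ∷ []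
    B₁ = inj₁ 0F ∷ inj₁ 1F ∷ []
    B₂ = inj₁ 2F ∷ inj₁ 3F ∷ []
    B₃ = inj₁ 4F ∷ inj₁ 5F ∷ inj₁ 6F ∷ inj₁ 7F ∷ []
    C  = inj₂ c ∷ inj₂ c′ ∷ []

  grow↭ : ∀ κ u l → u ∷ l ↭ frame → inj₂ u ∷ grow κ l ↭ map inj₂ frame ++ block′
  grow↭ generic       u l p = Perm.++⁺ʳ block′ (Perm.map⁺ inj₂ p)
  grow↭ distinguished u l p = ↭-trans (prep (inj₂ u) (Perm.++-comm block′ (map inj₂ l))) (grow↭ generic u l p)
  grow↭ extra         u l p = ↭-trans (prep (inj₂ u)
    (↭-trans (solve 3 (λ R L S → R ⊕ (L ⊕ S) ⊜ L ⊕ (R ⊕ S)) ↭-refl (map inj₁ rowB) (map inj₂ l) (map inj₁ rowA))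
      (Perm.++⁺ˡ (map inj₂ l) (↭-trans (↭-reflexive (sym (map-++ inj₁ rowB rowA))) (Perm.map⁺ inj₁ rows)))))
    (grow↭ generic u l p)
    where open CM

  arrange↭ : ∀ κ k → inj₁ k ∷ arrange κ k ↭ map inj₂ frame ++ block′
  arrange↭ κ k = ↭-trans (prep (inj₁ k) (parts κ)) (begin
    K ++ U ++ H ++ F ++ A ++ C
      ↭⟨ solve 6 (λ K U H F A C → K ⊕ (U ⊕ (H ⊕ (F ⊕ (A ⊕ C)))) ⊜ (K ⊕ (U ⊕ H)) ⊕ (F ⊕ (A ⊕ C))) ↭-refl K U H F A C ⟩
    (K ++ U ++ H) ++ F ++ A ++ C
      ≡⟨ cong (λ l → (K ++ l) ++ F ++ A ++ C) (sym (map-++ η (tl k) (hd k))) ⟩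
    map η (new k ∷ tl k ++ hd k) ++ F ++ A ++ C
      ↭⟨ Perm.++⁺ʳ (F ++ A ++ C) (Perm.map⁺ η (content k)) ⟩
    map η (β ∷ map new block ++ apexˡ) ++ F ++ A ++ C
      ≡⟨ cong (λ l → (B ++ block′ ++ l) ++ F ++ A ++ C) η-apex ⟩
    (B ++ block′ ++ X) ++ F ++ A ++ C
      ↭⟨ solve 6 (λ B N X F A C → (B ⊕ (N ⊕ X)) ⊕ (F ⊕ (A ⊕ C)) ⊜ (F ⊕ (A ⊕ (B ⊕ (C ⊕ X)))) ⊕ N) ↭-refl B block′ X F A C ⟩
    (F ++ A ++ B ++ C ++ X) ++ block′
      ≡⟨ cong (_++ block′) (sym map-frame) ⟩
    map inj₂ frame ++ block′ ∎)
    where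
    open PermutationReasoning
    open CM
    K U H A B C C₁ C₂ : List V′
    K  = [ inj₁ k ]
    U  = map η (tl k)
    H  = map η (hd k)
    A  = [ inj₂ a ]
    B  = [ inj₂ b ]
    C  = inj₂ c ∷ inj₂ c′ ∷ []
    C₁ = [ inj₂ c ]
    C₂ = [ inj₂ c′ ]
    middle : map η (α ∷ tl k ++ hd k ++ [ γ ]) ≡ A ++ U ++ H ++ C₁
    middle = cong (inj₂ a ∷_) (trans (map-++ η (tl k) _) (cong (U ++_) (map-++ η (hd k) [ γ ])))
    straight : F ++ map η (α ∷ tl k ++ hd k ++ [ γ ]) ++ C₂ ↭ U ++ H ++ F ++ A ++ C
    straight = ↭-trans (↭-reflexive (cong (λ l → F ++ l ++ C₂) middle))
      (solve 6 (λ U H F A C₁ C₂ → F ⊕ ((A ⊕ (U ⊕ (H ⊕ C₁))) ⊕ C₂) ⊜ U ⊕ (H ⊕ (F ⊕ (A ⊕ (C₁ ⊕ C₂))))) ↭-refl U H F A C₁ C₂)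
    parts : ∀ κ → arrange κ k ↭ U ++ H ++ F ++ A ++ C
    parts generic       = straight
    parts extra         = straight
    parts distinguished = ↭-trans (↭-reflexive (cong (_++ C₂ ++ F ++ A ++ U) (map-++ η (hd k) [ γ ])))
      (solve 6 (λ U H F A C₁ C₂ → (H ⊕ C₁) ⊕ (C₂ ⊕ (F ⊕ (A ⊕ U))) ⊜ U ⊕ (H ⊕ (F ⊕ (A ⊕ (C₁ ⊕ C₂))))) ↭-refl U H F A C₁ C₂)

  nbrs↭′ : ∀ u → u ∷ nbrs′ u ↭ frame′
  nbrs↭′ (inj₁ k) = ↭-trans (arrange↭ (newKind k) k) (↭-sym frame′↭)
  nbrs↭′ (inj₂ u) = ↭-trans (grow↭ (kind u) u (nbrs u) (nbrs↭ u)) (↭-sym frame′↭)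

  block-∋ : ∀ k → k ∈ block
  block-∋ 0F = here refl
  block-∋ 1F = there (here refl)
  block-∋ 2F = there (there (here refl))
  block-∋ 3F = there (there (there (here refl)))
  block-∋ 4F = there (there (there (there (here refl))))
  block-∋ 5F = there (there (there (there (there (here refl)))))
  block-∋ 6F = there (there (there (there (there (there (here refl))))))
  block-∋ 7F = there (there (there (there (there (there (there (here refl)))))))

  frame-∋′ : ∀ u → u ∈ frame′
  frame-∋′ (inj₁ k) = Perm.∈-resp-↭ (↭-sym frame′↭) (∈-++⁺ʳ (map inj₂ frame) (∈-map⁺ inj₁ (block-∋ k)))
  frame-∋′ (inj₂ u) = Perm.∈-resp-↭ (↭-sym frame′↭) (∈-++⁺ˡ (∈-map⁺ inj₂ (frame-∋ u)))

  frame!′ : Unique frame′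
  frame!′ = Unique-resp-↭ (↭-sym frame′↭)
    (Unique.++⁺ (Unique.map⁺ inj₂-injective frame!) (Unique.map⁺ inj₁-injective (Unique.allFin⁺ 8)) disjoint)
    where
    disjoint : ∀ {u} → ¬ (u ∈ map inj₂ frame × u ∈ block′)
    disjoint (p , q) with ∈-map⁻ inj₂ p | ∈-map⁻ inj₁ q
    ... | _ , _ , refl | _ , _ , ()

  -- Every dart of the extended layout lies on a known face

  chosen-sign : ∀ {x} → (x ≡ a ⊎ ∃ λ y → (x , y) ∈ pairs) → sign x ≡ true × kind x ≢ extra
  chosen-sign (inj₁ refl)     = D.sign-x , dist≢extra D.kind-x
  chosen-sign (inj₂ (_ , m)) = proj₁ (pair-signs (there m)) , proj₁ (pair-kinds (there m))

  -- The new vertices also turn from the second vertex of a pair to the first one of the next pair, and from c′ to i.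
  left-link : ∀ {x y} → (x , y) ∈ pairs → ∃ λ z → ∀ {j k} → Twins j k →
              ∀ {u v} → WrapDart (inj₁ j) (inj₁ k) (inj₂ x) (inj₂ z) u v → Cover′ u v
  left-link m with previous [ a ] head m
  ... | inj₁ refl               = c′ , ic′-face
  ... | inj₂ (x₀ , z , m₀ , zx) = z , link-face
    (proj₁ (pair-signs (there m))) (proj₂ (pair-signs (there m₀)))
    (proj₁ (pair-kinds (there m))) (proj₂ (pair-kinds (there m₀))) zx

  right-link : ∀ {x y} → (x , y) ∈ pairs → ∃ λ z → ∀ {j k} → Twins j k →
               ∀ {u v} → WrapDart (inj₁ j) (inj₁ k) (inj₂ z) (inj₂ y) u v → Cover′ u v
  right-link m with following m
  ... | z , chosen , yz = z , link-face
    (proj₁ (chosen-sign chosen)) (proj₂ (pair-signs (there m)))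
    (proj₂ (chosen-sign chosen)) (proj₂ (pair-kinds (there m))) yz

  a-link : ∃ λ z → ∀ {j k} → Twins j k →
           ∀ {u v} → WrapDart (inj₁ j) (inj₁ k) (inj₂ a) (inj₂ z) u v → Cover′ u v
  a-link with final head
  ... | _ , z , m , za = z , link-face
    D.sign-x (proj₂ (pair-signs (there m))) (dist≢extra D.kind-x) (proj₂ (pair-kinds (there m))) za

  Both : V → Fin 8 → Set
  Both u k = Cover′ (inj₂ u) (inj₁ k) × Cover′ (inj₁ k) (inj₂ u)

  old-member : ∀ {x y} → (x , y) ∈ (c , c′) ∷ pairs →
               (inj₂ x , inj₂ y) ∈ (inj₁ 2F , inj₁ 3F) ∷ (inj₂ c , inj₂ c′) ∷ pairs′
  old-member (here refl) = there (here refl)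
  old-member (there m)   = there (there (∈-++⁺ˡ (∈-map⁺ old² m)))

  module OldPair {x y f l : V} (m : (x , y) ∈ (c , c′) ∷ pairs) (P : Pair generic x y f l) where
    module P = Pair P

    -- The piece of the old quadrilateral `l x f y` on the side of `l`: all its corners are inner
    -- ones, so it is finished. The piece `end`, on the side of `f`, stays open.
    start : Quad Step′ (inj₂ l) (inj₂ x)
    start = mkQuad
      (orient-true P.sign-x (Adj-cong (sym (nbrs-generic P.kind-x)) (Adj-join (Last-map inj₂ P.last-x) first)))
      (pair-adj′ 0F m)
      (orient-false P.sign-y (Adj-cong (sym (nbrs-generic P.kind-y)) (Adj-join (Last-map inj₂ P.last-y) first)))
      (old-step P.turn-l)

    end : ∀ {u v} → WrapDart (inj₂ x) (inj₂ y) (inj₂ f) (inj₁ 7F) u v → Cover′ u v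
    end = onWrap′ (old-member m) (Pair′.first-x (old-pair m P)) (Pair′.last-x (old-pair m P))

  into-even : ∀ {x y} → (x , y) ∈ (c , c′) ∷ pairs → ∀ k → even k ≡ true →
              Cover′ (inj₂ x) (inj₁ k) × Cover′ (inj₁ k) (inj₂ y)
  into-even m k ek with before-even k ek
  ... | inj₂ (j , ej , jk , _) = pair-face m ej ek jk f→y , pair-face m ej ek jk y→l
  ... | inj₁ refl with generics m
  ...   | _ , _ , P , _ = onQuad′ (rotate (OldPair.start m P)) , onQuad′ (rotate (rotate (OldPair.start m P)))

  from-odd : ∀ {x y} → (x , y) ∈ (c , c′) ∷ pairs → ∀ k → even k ≡ false →
             Cover′ (inj₁ k) (inj₂ x) × Cover′ (inj₂ y) (inj₁ k)
  from-odd m k ek with after-odd k ek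
  ... | inj₂ (j , ej , kj , _) = pair-face m ek ej kj x→f , pair-face m ek ej kj l→x
  ... | inj₁ refl with generics m
  ...   | _ , _ , P , _ = OldPair.end m P l→x , OldPair.end m P y→l

  Linked : V → V → Set
  Linked x y = ∀ {j k} → Twins j k → ∀ {u v} → WrapDart (inj₁ j) (inj₁ k) (inj₂ x) (inj₂ y) u v → Cover′ u v

  by-parity : ∀ {P : Fin 8 → Set} → (∀ k → even k ≡ true → P k) → (∀ k → even k ≡ false → P k) → ∀ k → P k
  by-parity f g k with even k in e
  ... | true  = f k e
  ... | false = g k e

  -- Of the two darts joining `x` and `k`, one lies on a face within the pair and one on a face
  -- shared with the preceding vertex of the cyclic chain; the parity of `k` decides which.
  both-x : ∀ {x y z} → (x , y) ∈ (c , c′) ∷ pairs → Linked x z → ∀ k → Both x k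
  both-x m link = by-parity
    (λ k e → proj₁ (into-even m k e) , link (proj₂ (after-even k e)) x→f)
    (λ k e → link (proj₂ (before-odd k e)) f→y , proj₁ (from-odd m k e))

  both-y : ∀ {x y z} → (x , y) ∈ (c , c′) ∷ pairs → Linked z y → ∀ k → Both y k
  both-y m link = by-parity
    (λ k e → link (proj₂ (after-even k e)) l→x , proj₂ (into-even m k e))
    (λ k e → proj₂ (from-odd m k e) , link (proj₂ (before-odd k e)) y→l)

  both-c : ∀ k → Both c k
  both-c = by-parity
    (λ k e → proj₁ (into-even (here refl) k e) , local (proj₁ (cover-even k e)))
    (λ k e → local (proj₁ (cover-odd k e)) , proj₁ (from-odd (here refl) k e))

  ab-start : ∀ {u v} → WrapDart (inj₂ a) (inj₂ b) (inj₁ 0F) (inj₂ l₀) u v → Cover′ u v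
  ab-start = onWrap′ (there (there (∈-++⁺ʳ (map old² pairs) (here refl))))
    (Pair′.first-x ab-pair) (Pair′.last-x ab-pair)
    where
    ab-pair = proj₁ (proj₂ (proj₂ ab-generic))

  both-a : ∀ k → Both a k
  both-a = by-parity (λ k e → into k e , proj₂ a-link (proj₂ (after-even k e)) x→f)
                     (λ k e → proj₂ a-link (proj₂ (before-odd k e)) f→y , from k e)
    where
    into : ∀ k → even k ≡ true → Cover′ (inj₂ a) (inj₁ k)
    into k e with before-even k e
    ... | inj₁ refl               = ab-start x→f
    ... | inj₂ (j , ej , jk , j≢7) = ab-face ej e jk j≢7 f→y
    from : ∀ k → even k ≡ false → Cover′ (inj₁ k) (inj₂ a)
    from k e with after-odd k e
    ... | inj₁ refl               = local cover-7α
    ... | inj₂ (j , ej , kj , k≢7) = ab-face e ej kj k≢7 x→f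

  both-b : ∀ k → Both b k
  both-b = by-parity (λ k e → local (proj₂ (cover-even k e)) , into k e)
                     (λ k e → from k e , local (proj₂ (cover-odd k e)))
    where
    into : ∀ k → even k ≡ true → Cover′ (inj₁ k) (inj₂ b)
    into k e with before-even k e
    ... | inj₁ refl               = ab-start f→y
    ... | inj₂ (j , ej , jk , j≢7) = ab-face ej e jk j≢7 y→l
    from : ∀ k → even k ≡ false → Cover′ (inj₂ b) (inj₁ k)
    from k e with after-odd k e
    ... | inj₁ refl               = local cover-β7
    ... | inj₂ (j , ej , kj , k≢7) = ab-face e ej kj k≢7 l→x

  both : ∀ {u} → u ∈ frame → ∀ k → Both u k
  both u∈ with ∈-++⁻ (flat pairs) u∈
  ... | inj₂ (here refl)                         = both-a
  ... | inj₂ (there (here refl))                 = both-b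
  ... | inj₂ (there (there (here refl)))         = both-c
  ... | inj₂ (there (there (there (here refl)))) = both-y (here refl) ic′-face
  ... | inj₂ (there (there (there (there r∈)))) with any-if h r∈
  ...   | inj₁ (ht , here refl) = λ k → Product.swap (Product.map local local (cover-ρ ht k))
  both u∈ | inj₁ p∈ with flat-∈ p∈
  ... | x , y , m , inj₁ refl = both-x (there m) (proj₂ (left-link m))
  ... | x , y , m , inj₂ refl = both-y (there m) (proj₂ (right-link m))

  -- Only open quadrilaterals change: their darts at `l` go to the end piece at `0F`, their darts at
  -- `f` to the end piece at `7F`.
  old-cover : ∀ {u v} → Cover u v → Cover′ (inj₂ u) (inj₂ v)
  old-cover (onQuad q)    = onQuad′ (old-quad q)
  old-cover (onSpecial m) = onSpecial′ (∈-map⁺ old² m)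
  old-cover (onWrap {f = f} {l} (here refl) fst lst d)
    rewrite First-unique fst D.first-x | Last-unique lst D.last-x = dist-dart d
    where
    dist-dart : ∀ {u v} → WrapDart a b r l₀ u v → Cover′ (inj₂ u) (inj₂ v)
    dist-dart l→x = ab-start l→x
    dist-dart x→f = local cover-αρ
    dist-dart f→y = local cover-ρβ
    dist-dart y→l = ab-start y→l
  old-cover (onWrap (there m) fst lst d) with generics m
  ... | f , l , P , _ rewrite First-unique fst (Pair.first-x P) | Last-unique lst (Pair.last-x P) = pair-dart d
    where
    pair-dart : ∀ {u v} → WrapDart _ _ f l u v → Cover′ (inj₂ u) (inj₂ v)
    pair-dart l→x = onQuad′ (OldPair.start m P)
    pair-dart x→f = OldPair.end m P x→f
    pair-dart f→y = OldPair.end m P f→y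
    pair-dart y→l = onQuad′ (rotate (rotate (rotate (OldPair.start m P))))

  cover′ : ∀ {u v} → u ≢ v → Cover′ u v
  cover′ {inj₁ j} {inj₁ k} j≢k = local (cover-new (λ eq → j≢k (cong inj₁ eq)))
  cover′ {inj₁ k} {inj₂ u} _   = proj₂ (both (frame-∋ u) k)
  cover′ {inj₂ u} {inj₁ k} _   = proj₁ (both (frame-∋ u) k)
  cover′ {inj₂ u} {inj₂ v} u≢v = old-cover (cover (λ eq → u≢v (cong inj₂ eq)))

  extended : State h V′
  extended = record
    { layout       = layout′
    ; frame!       = frame!′
    ; frame-∋      = frame-∋′
    ; nbrs↭        = nbrs↭′
    ; head         = First-++ (First-map old² head)
    ; generics     = generics′
    ; dist         = η q , dist′
    ; sign-r       = sign-r′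
    ; turn-r       = turn-r′
    ; special!     = Unique.map⁺
        (λ eq → cong₂ _,_ (inj₂-injective (cong proj₁ eq)) (inj₂-injective (cong proj₂ eq)))
        special!
    ; special-step = special-step′
    ; cover        = cover′
    }

-- Closing the open corners

module Close {h : Bool} {V : Set} (st : State h V) where
  open State st
  open Steps sign nbrs using (CStep)

  close : ∀ {u x y} → Step u x y → CStep u x y
  close {u} = orient-map (λ x → x) inj₁ (sign u)

  -- When nothing more is inserted, the open corner is an ordinary turn from the last to the first
  -- neighbour, and the open quadrilateral is a face.
  wrapped : ∀ {κ x y f l} → Pair κ x y f l → CStep f x y → ∀ {u v} → WrapDart x y f l u v → Quad CStep u v
  wrapped {x = x} {y} {f} {l} P turn-f = λ
    { l→x → base ; x→f → rotate base ; f→y → rotate (rotate base) ; y→l → rotate (rotate (rotate base)) }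
    where
    module P = Pair P
    base : Quad CStep l x
    base = mkQuad (orient-true P.sign-x (inj₂ (P.last-x , P.first-x))) turn-f
                  (orient-false P.sign-y (inj₂ (P.last-y , P.first-y))) (close P.turn-l)

  turn-apex : CStep r a b
  turn-apex with ifT h turn-r
  ... | inj₁ (_ , _ , f , l) = orient-true sign-r (inj₂ (l , f))
  ... | inj₂ (_ , adj)       = orient-true sign-r (inj₁ adj)

  face : ∀ {u v} → Cover u v → Quad CStep u v ⊎ (u , v) ∈ special
  face (onQuad (mkQuad p q r s)) = inj₁ (mkQuad (close p) (close q) (close r) (close s))
  face (onSpecial m)             = inj₂ m
  face (onWrap (here refl) fst lst d)
    rewrite First-unique fst (Pair.first-x (proj₂ dist)) | Last-unique lst (Pair.last-x (proj₂ dist)) =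
    inj₁ (wrapped (proj₂ dist) turn-apex d)
  face (onWrap (there m) fst lst d) with generics m
  ... | f , l , P , turn-f rewrite First-unique fst (Pair.first-x P) | Last-unique lst (Pair.last-x P) =
    inj₁ (wrapped P (close turn-f) d)

  private
    closed! : ∀ u → Unique (u ∷ nbrs u)
    closed! u = Unique-resp-↭ (↭-sym (nbrs↭ u)) frame!

  toMap : Map V
  toMap = record
    { sign         = sign
    ; nbrs         = nbrs
    ; unique       = λ u → tail! (closed! u)
    ; complete     = λ {u} {v} v≢u → others v≢u (Perm.∈-resp-↭ (↭-sym (nbrs↭ u)) (frame-∋ v))
    ; proper       = λ {u} u∈ → head! (closed! u) u∈
    ; special      = special
    ; special!     = special!
    ; special-step = λ q → Product.map₂ close (special-step q)
    ; faces        = λ u≢v → face (cover u≢v)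
    }
    where
    tail! : ∀ {x} {l : List V} → Unique (x ∷ l) → Unique l
    tail! (_ ∷ u) = u
    head! : ∀ {x} {l : List V} → Unique (x ∷ l) → x ∉ l
    head! (x∉ ∷ _) x∈ = All.lookup x∉ x∈ refl
    others : ∀ {v u} {l : List V} → v ≢ u → v ∈ u ∷ l → v ∈ l
    others v≢u (here eq) = ⊥-elim (v≢u eq)
    others v≢u (there p) = p

-- Verified search for the finite checks

_<|>_ : ∀ {A : Set} → Maybe A → Maybe A → Maybe A
just x  <|> m = just x
nothing <|> m = m

_&_ : ∀ {A B : Set} → Maybe A → Maybe B → Maybe (A × B)
just x & just y = just (x , y)
_      & _      = nothing

-- Only positive answers are needed from these searches, so they return evidence in `Maybe`; that it
-- is present for the given data is established by evaluation.
∀? : ∀ {n} {P : Fin n → Set} → (∀ k → Maybe (P k)) → Maybe (∀ k → P k)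
∀? {zero}  f = just λ ()
∀? {suc n} f = Maybe.map (λ { (p , q) → λ { zero → p ; (suc k) → q k } }) (f zero & ∀? (λ k → f (suc k)))

every? : ∀ {A : Set} {P : A → Set} (l : List A) → (∀ x → Maybe (P x)) → Maybe (∀ {x} → x ∈ l → P x)
every? []      f = just λ ()
every? (x ∷ l) f = Maybe.map (λ { (p , q) → λ { (here refl) → p ; (there m) → q m } }) (f x & every? l f)

some? : ∀ {A B : Set} (l : List A) → (∀ {x} → x ∈ l → Maybe B) → Maybe B
some? []      f = nothing
some? (x ∷ l) f = f (here refl) <|> some? l (λ m → f (there m))

first? : ∀ {A : Set} (l : List A) → Maybe (∃ (First l))
first? []      = nothing
first? (x ∷ l) = just (x , first)

last? : ∀ {A : Set} (l : List A) → Maybe (∃ (Last l))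
last? []      = nothing
last? (x ∷ l) = just (last-exists x l)

when? : ∀ {P : Set} b → (b ≡ true → Maybe P) → Maybe (b ≡ true → P)
when? true  f = Maybe.map (λ p _ → p) (f refl)
when? false f = just λ ()

module Search {A : Set} (_≟_ : DecidableEquality A) where

  same? : ∀ x y → Maybe (x ≡ y)
  same? x y = dec⇒maybe (x ≟ y)

  next? : ∀ l x → Maybe (∃ λ y → Adj l x y)
  next? (z ∷ w ∷ l) x =
    Maybe.map (λ { refl → w , here }) (same? z x) <|> Maybe.map (Product.map₂ there) (next? (w ∷ l) x)
  next? _           x = nothing

  previous? : ∀ l y → Maybe (∃ λ x → Adj l x y)
  previous? (z ∷ w ∷ l) y =
    Maybe.map (λ { refl → z , here }) (same? w y) <|> Maybe.map (Product.map₂ there) (previous? (w ∷ l) y)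
  previous? _           y = nothing

  first-is? : ∀ l x → Maybe (First l x)
  first-is? l x = first? l >>= λ { (y , p) → Maybe.map (λ { refl → p }) (same? y x) }

  last-is? : ∀ l x → Maybe (Last l x)
  last-is? l x = last? l >>= λ { (y , p) → Maybe.map (λ { refl → p }) (same? y x) }

  turn? : ∀ b l (x : A) → Maybe (∃ (orient b (Adj l) x))
  turn? true  l x = next? l x
  turn? false l x = previous? l x

  segment-turn? : ∀ b segs (x : A) → Maybe (∃ (orient b (λ x y → Any (λ seg → Adj seg x y) segs) x))
  segment-turn? true  []         x = nothing
  segment-turn? true  (l ∷ segs) x =
    Maybe.map (Product.map₂ here) (next? l x) <|> Maybe.map (Product.map₂ there) (segment-turn? true segs x)
  segment-turn? false []         x = nothing
  segment-turn? false (l ∷ segs) x =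
    Maybe.map (Product.map₂ here) (previous? l x) <|> Maybe.map (Product.map₂ there) (segment-turn? false segs x)

  module _ {Step : A → A → A → Set} (step? : ∀ u x → Maybe (∃ (Step u x))) where

    step-to? : ∀ u x y → Maybe (Step u x y)
    step-to? u x y = step? u x >>= λ { (z , p) → Maybe.map (λ { refl → p }) (same? z y) }

    quad? : ∀ u v → Maybe (Quad Step u v)
    quad? u v =
      step? v u       >>= λ { (w , p) →
      step? w v       >>= λ { (t , q) →
      step-to? t w u  >>= λ r →
      step-to? u t v  >>= λ s → just (mkQuad p q r s) } }

  wrapDart? : ∀ x y f l u v → Maybe (WrapDart x y f l u v)
  wrapDart? x y f l u v =
    Maybe.map (λ { (refl , refl) → l→x }) (same? u l & same? v x) <|>
    (Maybe.map (λ { (refl , refl) → x→f }) (same? u x & same? v f) <|>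
    (Maybe.map (λ { (refl , refl) → f→y }) (same? u f & same? v y) <|>
    Maybe.map (λ { (refl , refl) → y→l }) (same? u y & same? v l)))

  open DecMembership _≟_ public using (_∈?_)
  open DecUnique _≟_ public using (unique?)

chain? : ∀ {A : Set} {P : A → A → Set} (l : List A) → (∀ x y → Maybe (P x y)) →
         Maybe (∀ {x y} → Adj l x y → P x y)
chain? []          f = just λ ()
chain? (x ∷ [])    f = just λ { (there ()) }
chain? (x ∷ y ∷ l) f =
  Maybe.map (λ { (p , q) → λ { here → p ; (there m) → q m } }) (f x y & chain? (y ∷ l) f)

-- A cyclic list is checked as a linear one with its first element repeated at the end.
cycle? : ∀ {A : Set} {P : A → A → Set} (l : List A) → (∀ x y → Maybe (P x y)) →
         Maybe (∀ {x y} → CAdj l x y → P x y)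
cycle? []      f = just λ { (inj₁ ()) ; (inj₂ ()) }
cycle? (x ∷ l) f = Maybe.map
  (λ g → λ { (inj₁ q) → g (Adj-++ˡ q) ; (inj₂ (q , first)) → g (Adj-join q first) })
  (chain? (x ∷ l ++ [ x ]) f)

kind? : (κ κ′ : Kind) → Maybe (κ ≡ κ′)
kind? generic       generic       = just refl
kind? distinguished distinguished = just refl
kind? extra         extra         = just refl
kind? _             _             = nothing

module CheckState (h : Bool) {n : ℕ} (lay : Layout (Fin n)) where
  open LayoutProperties h lay
  open Search (Fin._≟_ {n})

  step? : ∀ u x → Maybe (∃ (Step u x))
  step? u x = turn? (sign u) (nbrs u) x

  sign? : ∀ u b → Maybe (sign u ≡ b)
  sign? u b = dec⇒maybe (sign u Bool.≟ b)

  pair? : ∀ κ x y f l → Maybe (Pair κ x y f l)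
  pair? κ x y f l =
    kind? (kind x) κ >>= λ kx → kind? (kind y) κ >>= λ ky →
    sign? x true >>= λ sx → sign? y false >>= λ sy →
    first-is? (nbrs x) f >>= λ fx → first-is? (nbrs y) f >>= λ fy →
    last-is? (nbrs x) l >>= λ lx → last-is? (nbrs y) l >>= λ ly →
    step-to? step? l y x >>= λ tl →
    just (record { kind-x = kx ; kind-y = ky ; sign-x = sx ; sign-y = sy ; first-x = fx ; first-y = fy
                 ; last-x = lx ; last-y = ly ; turn-l = tl })

  generic? : ∀ p → Maybe (GenericPair (proj₁ p) (proj₂ p))
  generic? (x , y) =
    first? (nbrs x) >>= λ { (f , _) → last? (nbrs x) >>= λ { (l , _) →
    pair? generic x y f l >>= λ P → step-to? step? f x y >>= λ t → just (f , l , P , t) } }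

  dist? : Maybe (∃ λ l → Pair distinguished a b r l)
  dist? = last? (nbrs a) >>= λ { (l , _) → Maybe.map (l ,_) (pair? distinguished a b r l) }

  apexTurn? : Maybe ApexTurn
  apexTurn? = go h
    where
    go : ∀ h → Maybe (if h then kind r ≡ extra × First (nbrs r) b × Last (nbrs r) a else Adj (nbrs r) a b)
    go true  = kind? (kind r) extra & (first-is? (nbrs r) b & last-is? (nbrs r) a)
    go false = next? (nbrs r) a >>= λ { (z , p) → Maybe.map (λ { refl → p }) (same? z b) }

  cover? : ∀ u v → Maybe (Cover u v)
  cover? u v =
    Maybe.map onSpecial (dec⇒maybe (DecMembership._∈?_ (≡-dec (Fin._≟_ {n}) (Fin._≟_ {n})) (u , v) special)) <|>
    (Maybe.map onQuad (quad? step? u v) <|>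
    some? ((a , b) ∷ (c , c′) ∷ pairs) λ { {x , y} m →
      first? (nbrs x) >>= λ { (f , p) → last? (nbrs x) >>= λ { (l , q) →
      Maybe.map (onWrap m p q) (wrapDart? x y f l u v) } } })

  covers? : Maybe (∀ {u v} → u ≢ v → Cover u v)
  covers? = Maybe.map (λ g → λ {u} {v} → g u v) (∀? λ u → ∀? λ v → try u v (u Fin.≟ v))
    where
    try : ∀ u v → Dec (u ≡ v) → Maybe (u ≢ v → Cover u v)
    try u v (yes eq) = just λ u≢v → ⊥-elim (u≢v eq)
    try u v (no _)   = Maybe.map (λ p _ → p) (cover? u v)

  nbrs? : (∀ u → u ∈ frame) → Unique frame → Maybe (∀ u → u ∷ nbrs u ↭ frame)
  nbrs? all! fr! = ∀? λ u →
    dec⇒maybe (unique? (u ∷ nbrs u)) >>= λ u! →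
    (∀? λ v → dec⇒maybe (v ∈? (u ∷ nbrs u))) >>= λ full →
    just (unique-↭ u! fr! (λ _ → all! _) (λ _ → full _))

  specialStep? : Maybe (∀ {d e} → CAdj special d e → proj₂ d ≡ proj₁ e × Step (proj₁ e) (proj₁ d) (proj₂ e))
  specialStep? = cycle? special λ d e → same? (proj₂ d) (proj₁ e) & step-to? step? (proj₁ e) (proj₁ d) (proj₂ e)

  state? : ∀ ℓ → Maybe (Σ (State h (Fin n)) λ st → length (State.special st) ≡ ℓ)
  state? ℓ =
    dec⇒maybe (unique? frame) >>= λ fr! →
    (∀? λ u → dec⇒maybe (u ∈? frame)) >>= λ all! →
    nbrs? all! fr! >>= λ perm →
    first-pair? >>= λ hd →
    every? ((c , c′) ∷ pairs) generic? >>= λ gen →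
    dist? >>= λ dst →
    sign? r true >>= λ sr →
    apexTurn? >>= λ tr →
    dec⇒maybe (DecUnique.unique? (≡-dec (Fin._≟_ {n}) (Fin._≟_ {n})) special) >>= λ sp! →
    specialStep? >>= λ sps →
    covers? >>= λ cov →
    dec⇒maybe (length special ≟ ℓ) >>= λ len →
    just (record { layout = lay ; frame! = fr! ; frame-∋ = all! ; nbrs↭ = perm ; head = hd ; generics = gen
                 ; dist = dst ; sign-r = sr ; turn-r = tr ; special! = sp! ; special-step = sps ; cover = cov }
         , len)
    where
    first-pair? : Maybe (First pairs (i , i′))
    first-pair? = Search.first-is? (≡-dec (Fin._≟_ {n}) (Fin._≟_ {n})) pairs (i , i′)

Loc-≟ : DecidableEquality Loc
Loc-≟ x y = map′ (λ eq → trans (sym (decode-code x)) (trans (cong decode eq) (decode-code y))) (cong code)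
                 (code x Fin.≟ code y)
  where
  code : Loc → Fin 12
  code (new k) = k ↑ˡ 4
  code α       = 8 ↑ʳ 0F
  code β       = 8 ↑ʳ 1F
  code γ       = 8 ↑ʳ 2F
  code ρ       = 8 ↑ʳ 3F
  corner : Fin 4 → Loc
  corner 0F = α
  corner 1F = β
  corner 2F = γ
  corner 3F = ρ
  decode : Fin 12 → Loc
  decode k = [ new , corner ]′ (splitAt 8 k)
  decode-code : ∀ x → decode (code x) ≡ x
  decode-code (new k) = cong [ new , corner ]′ (Fin.splitAt-↑ˡ 8 k 4)
  decode-code α       = refl
  decode-code β       = refl
  decode-code γ       = refl
  decode-code ρ       = refl

module CheckGadget (h : Bool) (table : Table) where
  open TableProperties h table
  open Search Loc-≟

  step? : ∀ u x → Maybe (∃ (LStep u x))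
  step? u x = segment-turn? (locSign u) (segs u) x

  local? : ∀ u v → Maybe (LCover u v)
  local? u v = Maybe.map inj₁ (quad? step? u v) <|> Maybe.map inj₂ (wrapDart? (new 2F) (new 3F) r′ q u v)

  content? : Maybe (∀ k → new k ∷ tl k ++ hd k ↭ β ∷ map new block ++ apexˡ)
  content? = ∀? λ k → sameElements (new k ∷ tl k ++ hd k) (β ∷ map new block ++ apexˡ)
    where
    sameElements : ∀ l m → Maybe (l ↭ m)
    sameElements l m =
      dec⇒maybe (unique? l) >>= λ l! → dec⇒maybe (unique? m) >>= λ m! →
      every? l (λ x → dec⇒maybe (x ∈? m)) >>= λ l⊆m → every? m (λ x → dec⇒maybe (x ∈? l)) >>= λ m⊆l →
      just (unique-↭ l! m! l⊆m m⊆l)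

  rows? : Maybe (rowB ++ rowA ↭ block)
  rows? =
    dec⇒maybe (F.unique? (rowB ++ rowA)) >>= λ r! → dec⇒maybe (F.unique? block) >>= λ b! →
    every? (rowB ++ rowA) (λ x → dec⇒maybe (x F.∈? block)) >>= λ r⊆b →
    every? block (λ x → dec⇒maybe (x F.∈? (rowB ++ rowA))) >>= λ b⊆r →
    just (unique-↭ r! b! r⊆b b⊆r)
    where module F = Search (Fin._≟_ {8})

  tl-β? : Maybe (∀ k → k ≢ 7F → First (tl k) β)
  tl-β? = ∀? λ k → try k (k Fin.≟ 7F)
    where
    try : ∀ k → Dec (k ≡ 7F) → Maybe (k ≢ 7F → First (tl k) β)
    try k (yes eq) = just λ k≢ → ⊥-elim (k≢ eq)
    try k (no _)   = Maybe.map (λ p _ → p) (first-is? (tl k) β)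

  cover-new? : Maybe (∀ {j k} → j ≢ k → LCover (new j) (new k))
  cover-new? = Maybe.map (λ g → λ {j} {k} → g j k) (∀? λ j → ∀? λ k → try j k (j Fin.≟ k))
    where
    try : ∀ j k → Dec (j ≡ k) → Maybe (j ≢ k → LCover (new j) (new k))
    try j k (yes eq) = just λ j≢k → ⊥-elim (j≢k eq)
    try j k (no _)   = Maybe.map (λ p _ → p) (local? (new j) (new k))

  apex-r′? : Maybe (if h then r′ ≡ ρ × First rowB 3F × Last rowA 2F
                    else LStep r′ (new 2F) (new 3F) × ∃ λ k → r′ ≡ new k × even k ≡ true)
  apex-r′? = go h
    where
    module F = Search (Fin._≟_ {8})
    isNew? : ∀ x → Maybe (∃ λ k → x ≡ new k × even k ≡ true)
    isNew? (new k) = Maybe.map (λ e → k , refl , e) (dec⇒maybe (even k Bool.≟ true))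
    isNew? _       = nothing
    go : ∀ h′ → Maybe (if h′ then r′ ≡ ρ × First rowB 3F × Last rowA 2F
                    else LStep r′ (new 2F) (new 3F) × ∃ λ k → r′ ≡ new k × even k ≡ true)
    go true  = same? r′ ρ & (F.first-is? rowB 3F & F.last-is? rowA 2F)
    go false = step-to? step? r′ (new 2F) (new 3F) & isNew? r′

  gadget? : Maybe (Gadget h)
  gadget? =
    content? >>= λ con → rows? >>= λ row → tl-β? >>= λ tlβ →
    first-is? (hd 2F) r′ >>= λ h₂ → first-is? (hd 3F) r′ >>= λ h₃ →
    last-is? (tl 2F) q >>= λ t₂ → last-is? (tl 3F) q >>= λ t₃ →
    step-to? step? q (new 3F) (new 2F) >>= λ tq →
    apex-r′? >>= λ ar →
    cover-new? >>= λ cn →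
    when? h (λ _ → ∀? λ k → local? (new k) ρ & local? ρ (new k)) >>= λ cρ →
    (∀? λ k → when? (even k) λ _ → local? (new k) γ & local? β (new k)) >>= λ ce →
    (∀? λ k → odd? (even k) (local? γ (new k) & local? (new k) β)) >>= λ co →
    local? (new 7F) α >>= λ c₁ → local? α ρ >>= λ c₂ → local? ρ β >>= λ c₃ → local? β (new 7F) >>= λ c₄ →
    just (record { table = table ; content = con ; rows = row ; tl-β = tlβ ; hd-2 = h₂ ; hd-3 = h₃
                 ; tl-2 = t₂ ; tl-3 = t₃ ; turn-q = tq ; apex-r′ = ar ; cover-new = cn ; cover-ρ = cρ
                 ; cover-even = ce ; cover-odd = co ; cover-7α = c₁ ; cover-αρ = c₂ ; cover-ρβ = c₃ ; cover-β7 = c₄ })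
    where
    odd? : ∀ {P : Set} b → Maybe P → Maybe (b ≡ false → P)
    odd? true  m = just λ ()
    odd? false m = Maybe.map (λ p _ → p) m

-- Larger numbers are not used.
loc : ℕ → Loc
loc 8 = α
loc 9 = β
loc 10 = γ
loc 11 = ρ
loc 0 = new 0F
loc 1 = new 1F
loc 2 = new 2F
loc 3 = new 3F
loc 4 = new 4F
loc 5 = new 5F
loc 6 = new 6F
loc _ = new 7F

row : {A : Set} {n : ℕ} → List (List A) → Fin n → List A
row []       k       = []
row (l ∷ _)  zero    = l
row (_ ∷ ls) (suc k) = row ls k

-- The gadget patterns and the starting embeddings

evenTable : Table
evenTable = record
  { hd = row (map (map loc)
      ([] ∷ [] ∷ (4 ∷ 1 ∷ 0 ∷ 5 ∷ 6 ∷ 3 ∷ 7 ∷ []) ∷ (4 ∷ 5 ∷ 1 ∷ 0 ∷ 2 ∷ 6 ∷ 7 ∷ []) ∷ [] ∷ [] ∷ [] ∷ [] ∷ []))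
  ; tl = row (map (map loc)
      ( (9 ∷ 7 ∷ 5 ∷ 1 ∷ 2 ∷ 3 ∷ 6 ∷ 4 ∷ [])
      ∷ (9 ∷ 7 ∷ 6 ∷ 2 ∷ 3 ∷ 0 ∷ 5 ∷ 4 ∷ [])
      ∷ (9 ∷ [])
      ∷ (9 ∷ [])
      ∷ (9 ∷ 1 ∷ 0 ∷ 5 ∷ 7 ∷ 6 ∷ 2 ∷ 3 ∷ [])
      ∷ (9 ∷ 1 ∷ 2 ∷ 7 ∷ 6 ∷ 4 ∷ 0 ∷ 3 ∷ [])
      ∷ (9 ∷ 5 ∷ 0 ∷ 2 ∷ 7 ∷ 3 ∷ 1 ∷ 4 ∷ [])
      ∷ (9 ∷ 5 ∷ 6 ∷ 2 ∷ 3 ∷ 1 ∷ 0 ∷ 4 ∷ [])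
      ∷ [] ))
  ; rowA = []
  ; rowB = block
  ; r′   = new 4F
  ; q    = β
  }

oddTable : Table
oddTable = record
  { hd = row (map (map loc)
      ([] ∷ [] ∷ (11 ∷ 0 ∷ 3 ∷ 1 ∷ []) ∷ (11 ∷ 4 ∷ 2 ∷ 0 ∷ 1 ∷ []) ∷ [] ∷ [] ∷ [] ∷ [] ∷ []))
  ; tl = row (map (map loc)
      ( (9 ∷ 6 ∷ 5 ∷ 7 ∷ 11 ∷ 4 ∷ 2 ∷ 1 ∷ 3 ∷ [])
      ∷ (9 ∷ 6 ∷ 4 ∷ 5 ∷ 7 ∷ 11 ∷ 0 ∷ 2 ∷ 3 ∷ [])
      ∷ (9 ∷ 7 ∷ 6 ∷ 4 ∷ 5 ∷ [])
      ∷ (9 ∷ 7 ∷ 6 ∷ 5 ∷ [])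
      ∷ (9 ∷ 11 ∷ 1 ∷ 2 ∷ 5 ∷ 6 ∷ 3 ∷ 0 ∷ 7 ∷ [])
      ∷ (9 ∷ 11 ∷ 1 ∷ 2 ∷ 3 ∷ 0 ∷ 6 ∷ 4 ∷ 7 ∷ [])
      ∷ (9 ∷ 3 ∷ 0 ∷ 1 ∷ 11 ∷ 4 ∷ 7 ∷ 5 ∷ 2 ∷ [])
      -- `β` comes late in the row of `7F`: the six entries before it lie between `a` and `b`, at
      -- the corner of the fifth filled face `7 a r b`.
      ∷ (1 ∷ 11 ∷ 4 ∷ 5 ∷ 6 ∷ 0 ∷ 9 ∷ 3 ∷ 2 ∷ [])
      ∷ [] ))
  ; rowA = 1F ∷ 2F ∷ []
  ; rowB = 3F ∷ 6F ∷ 4F ∷ 5F ∷ 7F ∷ 0F ∷ []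
  ; r′   = ρ
  ; q    = new 5F
  }

evenGadget : Gadget false
evenGadget = to-witness-T (CheckGadget.gadget? false evenTable) tt

oddGadget : Gadget true
oddGadget = to-witness-T (CheckGadget.gadget? true oddTable) tt

-- Numbers that are too large become the last vertex.
vertex : ∀ {n} → ℕ → Fin (suc n)
vertex         zero    = zero
vertex {zero}  (suc _) = zero
vertex {suc n} (suc k) = suc (vertex k)

closedWalk : {A : Set} → A → List A → List (A × A)
closedWalk x l = zip (x ∷ l) (l ++ [ x ])

record Seed (n : ℕ) : Set where
  constructor seed
  field
    rows        : List (List ℕ)
    walk        : ℕ × List ℕ
    pair        : ℕ × ℕ
    pairs       : List (ℕ × ℕ)
    a b c c′ r : ℕ

seedLayout : ∀ {n} → Bool → Seed n → Layout (Fin (suc n))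
seedLayout {n} h s = record
  { sign    = λ u → any (λ v → ⌊ u Fin.≟ vertex v ⌋) (S.r ∷ S.a ∷ S.c ∷ map proj₁ (S.pair ∷ S.pairs))
  ; nbrs    = λ u → map vertex (row S.rows u)
  ; kind    = λ u → if ⌊ u Fin.≟ vertex S.a ⌋ ∨ ⌊ u Fin.≟ vertex S.b ⌋ then distinguished
                    else if h ∧ ⌊ u Fin.≟ vertex S.r ⌋ then extra else generic
  ; special = closedWalk (vertex (proj₁ S.walk)) (map vertex (proj₂ S.walk))
  ; pairs   = map (Product.map vertex vertex) (S.pair ∷ S.pairs)
  ; i       = vertex (proj₁ S.pair)
  ; i′      = vertex (proj₂ S.pair)
  ; a       = vertex S.a
  ; b       = vertex S.b
  ; c       = vertex S.c
  ; c′      = vertex S.c′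
  ; r       = vertex S.r
  }
  where module S = Seed s

-- For `e = 0` the special face is one of the quadrilaterals, singled out so that all cases have the
-- same form.
SeedState : Bool → ℕ → ℕ → Set
SeedState h n e = Σ (State h (Fin n)) λ st → length (State.special st) ≡ 4 + e

seed7 : Seed 6
seed7 = seed
  ( (6 ∷ 1 ∷ 3 ∷ 2 ∷ 4 ∷ 5 ∷ [])
  ∷ (3 ∷ 5 ∷ 2 ∷ 0 ∷ 6 ∷ 4 ∷ [])
  ∷ (3 ∷ 1 ∷ 6 ∷ 5 ∷ 0 ∷ 4 ∷ [])
  ∷ (6 ∷ 0 ∷ 4 ∷ 1 ∷ 2 ∷ 5 ∷ [])
  ∷ (6 ∷ 5 ∷ 3 ∷ 2 ∷ 1 ∷ 0 ∷ [])
  ∷ (6 ∷ 2 ∷ 4 ∷ 1 ∷ 3 ∷ 0 ∷ [])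
  ∷ (0 ∷ 2 ∷ 4 ∷ 5 ∷ 1 ∷ 3 ∷ [])
  ∷ [])
  (1 , 4 ∷ 0 ∷ 2 ∷ 5 ∷ 6 ∷ [])
  (1 , 2) ([])
  3 0 4 5 6

state7 : SeedState true 7 2
state7 = to-witness-T (CheckState.state? true (seedLayout true seed7) 6) tt

seed8 : Seed 7
seed8 = seed
  ( (5 ∷ 3 ∷ 2 ∷ 4 ∷ 7 ∷ 6 ∷ 1 ∷ [])
  ∷ (7 ∷ 0 ∷ 5 ∷ 2 ∷ 3 ∷ 6 ∷ 4 ∷ [])
  ∷ (7 ∷ 4 ∷ 6 ∷ 0 ∷ 1 ∷ 3 ∷ 5 ∷ [])
  ∷ (7 ∷ 6 ∷ 5 ∷ 2 ∷ 0 ∷ 1 ∷ 4 ∷ [])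
  ∷ (7 ∷ 1 ∷ 3 ∷ 6 ∷ 0 ∷ 2 ∷ 5 ∷ [])
  ∷ (3 ∷ 1 ∷ 6 ∷ 4 ∷ 2 ∷ 0 ∷ 7 ∷ [])
  ∷ (3 ∷ 0 ∷ 5 ∷ 2 ∷ 4 ∷ 1 ∷ 7 ∷ [])
  ∷ (5 ∷ 6 ∷ 4 ∷ 2 ∷ 0 ∷ 3 ∷ 1 ∷ [])
  ∷ [])
  (2 , 4 ∷ 0 ∷ 7 ∷ [])
  (1 , 3) ((2 , 4) ∷ [])
  0 7 5 6 5

state8 : SeedState false 8 0
state8 = to-witness-T (CheckState.state? false (seedLayout false seed8) 4) tt

seed9 : Seed 8
seed9 = seed
  ( (8 ∷ 3 ∷ 5 ∷ 7 ∷ 2 ∷ 1 ∷ 6 ∷ 4 ∷ [])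
  ∷ (2 ∷ 8 ∷ 5 ∷ 0 ∷ 3 ∷ 4 ∷ 7 ∷ 6 ∷ [])
  ∷ (5 ∷ 8 ∷ 7 ∷ 4 ∷ 6 ∷ 1 ∷ 3 ∷ 0 ∷ [])
  ∷ (2 ∷ 1 ∷ 8 ∷ 7 ∷ 5 ∷ 4 ∷ 0 ∷ 6 ∷ [])
  ∷ (3 ∷ 7 ∷ 5 ∷ 6 ∷ 0 ∷ 2 ∷ 1 ∷ 8 ∷ [])
  ∷ (3 ∷ 4 ∷ 7 ∷ 2 ∷ 1 ∷ 6 ∷ 0 ∷ 8 ∷ [])
  ∷ (8 ∷ 1 ∷ 3 ∷ 5 ∷ 0 ∷ 2 ∷ 7 ∷ 4 ∷ [])
  ∷ (5 ∷ 6 ∷ 4 ∷ 3 ∷ 2 ∷ 1 ∷ 8 ∷ 0 ∷ [])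
  ∷ (6 ∷ 7 ∷ 5 ∷ 4 ∷ 3 ∷ 2 ∷ 1 ∷ 0 ∷ [])
  ∷ [])
  (2 , 1 ∷ 8 ∷ 0 ∷ 3 ∷ 4 ∷ 7 ∷ 6 ∷ [])
  (1 , 3) ((2 , 7) ∷ [])
  0 6 4 5 8

state9 : SeedState true 9 4
state9 = to-witness-T (CheckState.state? true (seedLayout true seed9) 8) tt

seed10 : Seed 9
seed10 = seed
  ( (2 ∷ 1 ∷ 6 ∷ 8 ∷ 9 ∷ 4 ∷ 3 ∷ 5 ∷ 7 ∷ [])
  ∷ (9 ∷ 2 ∷ 4 ∷ 3 ∷ 0 ∷ 7 ∷ 5 ∷ 6 ∷ 8 ∷ [])
  ∷ (7 ∷ 0 ∷ 8 ∷ 6 ∷ 1 ∷ 4 ∷ 5 ∷ 3 ∷ 9 ∷ [])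
  ∷ (6 ∷ 1 ∷ 9 ∷ 8 ∷ 7 ∷ 4 ∷ 0 ∷ 5 ∷ 2 ∷ [])
  ∷ (5 ∷ 3 ∷ 6 ∷ 7 ∷ 8 ∷ 2 ∷ 9 ∷ 1 ∷ 0 ∷ [])
  ∷ (6 ∷ 7 ∷ 3 ∷ 9 ∷ 4 ∷ 0 ∷ 1 ∷ 8 ∷ 2 ∷ [])
  ∷ (7 ∷ 4 ∷ 5 ∷ 3 ∷ 0 ∷ 2 ∷ 8 ∷ 1 ∷ 9 ∷ [])
  ∷ (9 ∷ 5 ∷ 4 ∷ 3 ∷ 6 ∷ 2 ∷ 1 ∷ 0 ∷ 8 ∷ [])
  ∷ (2 ∷ 0 ∷ 3 ∷ 4 ∷ 5 ∷ 6 ∷ 9 ∷ 1 ∷ 7 ∷ [])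
  ∷ (5 ∷ 2 ∷ 6 ∷ 8 ∷ 7 ∷ 1 ∷ 4 ∷ 3 ∷ 0 ∷ [])
  ∷ [])
  (2 , 1 ∷ 4 ∷ 0 ∷ 3 ∷ 5 ∷ 7 ∷ 9 ∷ 8 ∷ 6 ∷ [])
  (1 , 7) ((2 , 6) ∷ (3 , 5) ∷ [])
  0 8 4 9 2

state10 : SeedState false 10 6
state10 = to-witness-T (CheckState.state? false (seedLayout false seed10) 10) tt

seed11 : Seed 10
seed11 = seed
  ( (6 ∷ 10 ∷ 4 ∷ 3 ∷ 1 ∷ 5 ∷ 9 ∷ 8 ∷ 7 ∷ 2 ∷ [])
  ∷ (6 ∷ 5 ∷ 3 ∷ 8 ∷ 0 ∷ 4 ∷ 9 ∷ 7 ∷ 10 ∷ 2 ∷ [])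
  ∷ (7 ∷ 1 ∷ 0 ∷ 6 ∷ 5 ∷ 10 ∷ 4 ∷ 3 ∷ 8 ∷ 9 ∷ [])
  ∷ (7 ∷ 1 ∷ 10 ∷ 4 ∷ 5 ∷ 0 ∷ 8 ∷ 6 ∷ 2 ∷ 9 ∷ [])
  ∷ (10 ∷ 5 ∷ 1 ∷ 0 ∷ 8 ∷ 9 ∷ 7 ∷ 6 ∷ 2 ∷ 3 ∷ [])
  ∷ (10 ∷ 1 ∷ 2 ∷ 6 ∷ 8 ∷ 9 ∷ 4 ∷ 0 ∷ 7 ∷ 3 ∷ [])
  ∷ (8 ∷ 9 ∷ 0 ∷ 1 ∷ 2 ∷ 7 ∷ 10 ∷ 5 ∷ 3 ∷ 4 ∷ [])
  ∷ (8 ∷ 3 ∷ 2 ∷ 10 ∷ 5 ∷ 9 ∷ 0 ∷ 6 ∷ 1 ∷ 4 ∷ [])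
  ∷ (6 ∷ 7 ∷ 1 ∷ 3 ∷ 5 ∷ 4 ∷ 10 ∷ 2 ∷ 9 ∷ 0 ∷ [])
  ∷ (6 ∷ 10 ∷ 5 ∷ 4 ∷ 1 ∷ 2 ∷ 3 ∷ 8 ∷ 7 ∷ 0 ∷ [])
  ∷ (5 ∷ 3 ∷ 2 ∷ 6 ∷ 1 ∷ 7 ∷ 8 ∷ 0 ∷ 9 ∷ 4 ∷ [])
  ∷ [])
  (2 , 9 ∷ 1 ∷ 4 ∷ 0 ∷ 3 ∷ 5 ∷ 7 ∷ 10 ∷ 8 ∷ [])
  (0 , 1) ((2 , 3) ∷ (6 , 7) ∷ [])
  4 5 8 9 10

state11 : SeedState true 11 6
state11 = to-witness-T (CheckState.state? true (seedLayout true seed11) 10) tt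

seed12 : Seed 11
seed12 = seed
  ( (10 ∷ 2 ∷ 7 ∷ 9 ∷ 5 ∷ 8 ∷ 3 ∷ 1 ∷ 4 ∷ 11 ∷ 6 ∷ [])
  ∷ (10 ∷ 2 ∷ 7 ∷ 3 ∷ 11 ∷ 8 ∷ 4 ∷ 9 ∷ 5 ∷ 0 ∷ 6 ∷ [])
  ∷ (10 ∷ 7 ∷ 4 ∷ 8 ∷ 0 ∷ 6 ∷ 3 ∷ 11 ∷ 1 ∷ 5 ∷ 9 ∷ [])
  ∷ (1 ∷ 2 ∷ 11 ∷ 4 ∷ 7 ∷ 8 ∷ 9 ∷ 5 ∷ 0 ∷ 10 ∷ 6 ∷ [])
  ∷ (1 ∷ 10 ∷ 9 ∷ 7 ∷ 8 ∷ 11 ∷ 5 ∷ 2 ∷ 3 ∷ 0 ∷ 6 ∷ [])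
  ∷ (6 ∷ 2 ∷ 7 ∷ 0 ∷ 1 ∷ 3 ∷ 10 ∷ 9 ∷ 11 ∷ 8 ∷ 4 ∷ [])
  ∷ (10 ∷ 2 ∷ 11 ∷ 5 ∷ 3 ∷ 7 ∷ 0 ∷ 1 ∷ 4 ∷ 8 ∷ 9 ∷ [])
  ∷ (1 ∷ 5 ∷ 8 ∷ 0 ∷ 4 ∷ 10 ∷ 9 ∷ 2 ∷ 3 ∷ 11 ∷ 6 ∷ [])
  ∷ (1 ∷ 5 ∷ 2 ∷ 7 ∷ 0 ∷ 10 ∷ 4 ∷ 9 ∷ 11 ∷ 3 ∷ 6 ∷ [])
  ∷ (5 ∷ 8 ∷ 11 ∷ 4 ∷ 0 ∷ 1 ∷ 2 ∷ 6 ∷ 3 ∷ 10 ∷ 7 ∷ [])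
  ∷ (5 ∷ 9 ∷ 2 ∷ 6 ∷ 0 ∷ 1 ∷ 11 ∷ 4 ∷ 3 ∷ 8 ∷ 7 ∷ [])
  ∷ (6 ∷ 3 ∷ 0 ∷ 7 ∷ 8 ∷ 5 ∷ 1 ∷ 2 ∷ 10 ∷ 9 ∷ 4 ∷ [])
  ∷ [])
  (2 , 9 ∷ 1 ∷ 4 ∷ 10 ∷ 3 ∷ 6 ∷ 5 ∷ [])
  (2 , 6) ((3 , 7) ∷ (4 , 8) ∷ (5 , 11) ∷ [])
  0 1 10 9 10

state12 : SeedState false 12 4
state12 = to-witness-T (CheckState.state? false (seedLayout false seed12) 8) tt

seed13 : Seed 12
seed13 = seed
  ( (6 ∷ 4 ∷ 10 ∷ 7 ∷ 12 ∷ 2 ∷ 11 ∷ 3 ∷ 8 ∷ 9 ∷ 5 ∷ 1 ∷ [])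
  ∷ (9 ∷ 4 ∷ 7 ∷ 3 ∷ 6 ∷ 11 ∷ 0 ∷ 12 ∷ 2 ∷ 10 ∷ 5 ∷ 8 ∷ [])
  ∷ (10 ∷ 3 ∷ 0 ∷ 6 ∷ 1 ∷ 4 ∷ 9 ∷ 5 ∷ 11 ∷ 12 ∷ 7 ∷ 8 ∷ [])
  ∷ (11 ∷ 2 ∷ 12 ∷ 0 ∷ 5 ∷ 10 ∷ 9 ∷ 8 ∷ 6 ∷ 7 ∷ 4 ∷ 1 ∷ [])
  ∷ (10 ∷ 7 ∷ 0 ∷ 9 ∷ 5 ∷ 12 ∷ 2 ∷ 1 ∷ 3 ∷ 6 ∷ 11 ∷ 8 ∷ [])
  ∷ (12 ∷ 0 ∷ 4 ∷ 7 ∷ 1 ∷ 3 ∷ 11 ∷ 6 ∷ 8 ∷ 10 ∷ 9 ∷ 2 ∷ [])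
  ∷ (5 ∷ 1 ∷ 4 ∷ 8 ∷ 10 ∷ 2 ∷ 12 ∷ 7 ∷ 0 ∷ 11 ∷ 9 ∷ 3 ∷ [])
  ∷ (11 ∷ 12 ∷ 5 ∷ 8 ∷ 10 ∷ 6 ∷ 4 ∷ 0 ∷ 2 ∷ 9 ∷ 3 ∷ 1 ∷ [])
  ∷ (5 ∷ 11 ∷ 6 ∷ 7 ∷ 1 ∷ 10 ∷ 9 ∷ 2 ∷ 4 ∷ 12 ∷ 0 ∷ 3 ∷ [])
  ∷ (12 ∷ 6 ∷ 7 ∷ 8 ∷ 5 ∷ 11 ∷ 3 ∷ 0 ∷ 4 ∷ 10 ∷ 1 ∷ 2 ∷ [])
  ∷ (9 ∷ 0 ∷ 4 ∷ 2 ∷ 12 ∷ 7 ∷ 6 ∷ 1 ∷ 3 ∷ 11 ∷ 5 ∷ 8 ∷ [])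
  ∷ (6 ∷ 12 ∷ 4 ∷ 8 ∷ 10 ∷ 9 ∷ 2 ∷ 7 ∷ 3 ∷ 0 ∷ 5 ∷ 1 ∷ [])
  ∷ (9 ∷ 11 ∷ 8 ∷ 3 ∷ 10 ∷ 6 ∷ 0 ∷ 2 ∷ 7 ∷ 4 ∷ 1 ∷ 5 ∷ [])
  ∷ [])
  (2 , 9 ∷ 1 ∷ 4 ∷ [])
  (0 , 11) ((1 , 10) ∷ (2 , 4) ∷ (3 , 7) ∷ [])
  5 9 6 8 12

state13 : SeedState true 13 0
state13 = to-witness-T (CheckState.state? true (seedLayout true seed13) 4) tt

seed14 : Seed 13
seed14 = seed
  ( (6 ∷ 7 ∷ 9 ∷ 12 ∷ 11 ∷ 3 ∷ 1 ∷ 10 ∷ 8 ∷ 5 ∷ 13 ∷ 4 ∷ 2 ∷ [])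
  ∷ (6 ∷ 12 ∷ 4 ∷ 9 ∷ 10 ∷ 3 ∷ 7 ∷ 5 ∷ 13 ∷ 0 ∷ 8 ∷ 11 ∷ 2 ∷ [])
  ∷ (6 ∷ 11 ∷ 3 ∷ 10 ∷ 13 ∷ 5 ∷ 12 ∷ 7 ∷ 9 ∷ 1 ∷ 0 ∷ 8 ∷ 4 ∷ [])
  ∷ (5 ∷ 13 ∷ 0 ∷ 10 ∷ 9 ∷ 1 ∷ 4 ∷ 7 ∷ 6 ∷ 8 ∷ 11 ∷ 12 ∷ 2 ∷ [])
  ∷ (9 ∷ 1 ∷ 11 ∷ 10 ∷ 13 ∷ 12 ∷ 5 ∷ 8 ∷ 0 ∷ 6 ∷ 3 ∷ 7 ∷ 2 ∷ [])
  ∷ (3 ∷ 11 ∷ 8 ∷ 1 ∷ 0 ∷ 6 ∷ 12 ∷ 4 ∷ 13 ∷ 10 ∷ 9 ∷ 7 ∷ 2 ∷ [])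
  ∷ (5 ∷ 8 ∷ 2 ∷ 7 ∷ 4 ∷ 13 ∷ 12 ∷ 9 ∷ 10 ∷ 11 ∷ 3 ∷ 0 ∷ 1 ∷ [])
  ∷ (6 ∷ 3 ∷ 0 ∷ 5 ∷ 12 ∷ 13 ∷ 10 ∷ 9 ∷ 2 ∷ 11 ∷ 8 ∷ 1 ∷ 4 ∷ [])
  ∷ (9 ∷ 0 ∷ 6 ∷ 11 ∷ 3 ∷ 5 ∷ 7 ∷ 1 ∷ 10 ∷ 13 ∷ 12 ∷ 4 ∷ 2 ∷ [])
  ∷ (6 ∷ 0 ∷ 5 ∷ 7 ∷ 12 ∷ 4 ∷ 8 ∷ 10 ∷ 3 ∷ 13 ∷ 11 ∷ 2 ∷ 1 ∷ [])
  ∷ (6 ∷ 4 ∷ 5 ∷ 7 ∷ 11 ∷ 3 ∷ 13 ∷ 12 ∷ 2 ∷ 8 ∷ 0 ∷ 9 ∷ 1 ∷ [])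
  ∷ (5 ∷ 3 ∷ 0 ∷ 10 ∷ 13 ∷ 12 ∷ 9 ∷ 1 ∷ 7 ∷ 4 ∷ 6 ∷ 8 ∷ 2 ∷ [])
  ∷ (5 ∷ 8 ∷ 4 ∷ 13 ∷ 11 ∷ 6 ∷ 0 ∷ 3 ∷ 10 ∷ 7 ∷ 2 ∷ 9 ∷ 1 ∷ [])
  ∷ (3 ∷ 1 ∷ 0 ∷ 6 ∷ 11 ∷ 7 ∷ 10 ∷ 9 ∷ 12 ∷ 5 ∷ 4 ∷ 8 ∷ 2 ∷ [])
  ∷ [])
  (2 , 9 ∷ 1 ∷ 4 ∷ 11 ∷ 7 ∷ [])
  (2 , 7) ((3 , 11) ∷ (4 , 8) ∷ (5 , 13) ∷ (6 , 12) ∷ [])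
  0 1 9 10 6

state14 : SeedState false 14 2
state14 = to-witness-T (CheckState.state? false (seedLayout false seed14) 6) tt

-- Embeddings of every order from towers of layouts

-- The face lengths exceed 4 by e in total; the equation is 4 F + e = p (p − 1) without subtraction.
Embedding : ℕ → ℕ → Set
Embedding e p = Σ (Rotation p) λ R → FacesAtLeast 4 R × 4 * numFaces R + e + p ≡ p * p

realize : ∀ {p e} → 3 ≤ p → (M : Map (Fin p)) → length (Map.special M) ≡ 4 + e → Embedding e p
realize {suc (suc (suc n))} {e} (s≤s (s≤s (s≤s _))) M len =
  rotation , facesAtLeast (subst (4 ≤_) (sym len) (m≤m+n 4 e)) , numFaces-special len
  where open Realize M

-- Each step passes from `V` to `Fin 8 ⊎ V`. The numbering is carried alongside and applied once at
-- the end, which keeps index arithmetic out of the construction.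
record Numbered (h : Bool) (p e : ℕ) : Set₁ where
  field
    V       : Set
    number  : V ↔ Fin p
    state   : State h V
    length≡ : length (State.special state) ≡ 4 + e

extend : ∀ {h p e} → Gadget h → Numbered h p e → Numbered h (8 + p) e
extend gadget N = record
  { number  = ↔-trans (↔-refl ⊎-↔ number) (↔-sym Fin.+↔⊎)
  ; state   = Extend.extended state gadget
  ; length≡ = trans (length-map _ (State.special state)) length≡
  }
  where open Numbered N

tower : ∀ {h p e} → Gadget h → SeedState h p e → ∀ m → Numbered h (m * 8 + p) e
tower gadget (st , len) zero    = record { number = ↔-refl ; state = st ; length≡ = len }
tower gadget s          (suc m) = extend gadget (tower gadget s m)

embedding : ∀ {h p e} → 3 ≤ p → Numbered h p e → Embedding e p
embedding 3≤p N =
  realize 3≤p (Transport.relabel number (Close.toMap state)) (trans (length-map _ (State.special state)) length≡)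
  where open Numbered N

-- Orders four, five and six

module SmallCase {n : ℕ} (rows : List (List ℕ)) where
  open Search (Fin._≟_ {suc n})

  rotated : Fin (suc n) → List (Fin (suc n))
  rotated u = map vertex (row rows u)

  distinct? : ∀ {A : Set} {P : A → A → Set} → (∀ u v → Dec (u ≡ v)) → (∀ u v → Maybe (P u v)) →
              ∀ u v → Maybe (u ≢ v → P u v)
  distinct? _≟_ f u v with u ≟ v
  ... | yes eq = just λ u≢v → ⊥-elim (u≢v eq)
  ... | no _   = Maybe.map (λ p _ → p) (f u v)

  -- The residues of 4, 5 and 6 modulo 8 are served by the seeds of order 12, 13 and 14, so nothing
  -- is built on these embeddings and no layout is required: their faces are traced and counted by
  -- evaluation.
  small? : ∀ e → Maybe (Embedding e (suc n))
  small? e =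
    (∀? λ u → dec⇒maybe (unique? (rotated u))) >>= λ u! →
    (∀? λ u → ∀? λ v → distinct? Fin._≟_ (λ v u → dec⇒maybe (v ∈? rotated u)) v u) >>= λ full →
    (∀? λ u → dec⇒maybe (¬? (u ∈? rotated u))) >>= λ out →
    check (FromLists.rotation rotated u! (λ {u} {v} → full u v) (λ { {u} m refl → out u m }))
    where
    check : (R : Rotation (suc n)) → Maybe (Embedding e (suc n))
    check R =
      (∀? λ u → ∀? λ v → distinct?
        {P = λ u v → ∀ (k : Fin 3) → iter (faceStep R) (suc (toℕ k)) (u , v) ≢ (u , v)} Fin._≟_
        (λ u v → ∀? λ k → dec⇒maybe (¬? (iter (faceStep R) (suc (toℕ k)) (u , v) ≟ᵈ (u , v)))) u v) >>= λ big →
      dec⇒maybe (4 * numFaces R + e + suc n ≟ suc n * suc n) >>= λ faces →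
      just (R , (λ u v u≢v → long (λ k → iter (faceStep R) k (u , v) ≢ (u , v)) (big u v u≢v)) , faces)
      where
      _≟ᵈ_ = ≡-dec (Fin._≟_ {suc n}) (Fin._≟_ {suc n})
      long : ∀ (P : ℕ → Set) → (∀ (k : Fin 3) → P (suc (toℕ k))) → ∀ k → 1 ≤ k → k < 4 → P k
      long P f 1 _ _ = f 0F
      long P f 2 _ _ = f 1F
      long P f 3 _ _ = f 2F
      long P f (suc (suc (suc (suc _)))) _ (s≤s (s≤s (s≤s (s≤s ()))))

embedding₄ : Embedding 4 4
embedding₄ = to-witness-T (SmallCase.small?
  ((1 ∷ 3 ∷ 2 ∷ []) ∷ (0 ∷ 3 ∷ 2 ∷ []) ∷ (0 ∷ 3 ∷ 1 ∷ []) ∷ (0 ∷ 2 ∷ 1 ∷ []) ∷ []) 4) tt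

embedding₅ : Embedding 0 5
embedding₅ = to-witness-T (SmallCase.small?
  ( (1 ∷ 4 ∷ 3 ∷ 2 ∷ []) ∷ (0 ∷ 4 ∷ 2 ∷ 3 ∷ []) ∷ (0 ∷ 1 ∷ 3 ∷ 4 ∷ [])
  ∷ (0 ∷ 2 ∷ 4 ∷ 1 ∷ []) ∷ (0 ∷ 3 ∷ 1 ∷ 2 ∷ []) ∷ []) 0) tt

embedding₆ : Embedding 2 6
embedding₆ = to-witness-T (SmallCase.small?
  ( (1 ∷ 3 ∷ 4 ∷ 5 ∷ 2 ∷ []) ∷ (0 ∷ 4 ∷ 3 ∷ 2 ∷ 5 ∷ []) ∷ (0 ∷ 1 ∷ 5 ∷ 4 ∷ 3 ∷ [])
  ∷ (0 ∷ 4 ∷ 2 ∷ 5 ∷ 1 ∷ []) ∷ (0 ∷ 1 ∷ 3 ∷ 5 ∷ 2 ∷ []) ∷ (0 ∷ 2 ∷ 3 ∷ 4 ∷ 1 ∷ []) ∷ []) 2) tt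

-- Euler's formula and the genus

numFaces-bound : ∀ {p} (R : Rotation p) → FacesAtLeast 4 R → 4 * numFaces R + p ≤ p * p
numFaces-bound {p} R big = subst (4 * numFaces R + p ≤_) (length-darts p) (+-monoˡ-≤ p (Orbits.numFaces-upper R big))

genus-lower : ∀ n h → EmbedsIn 4 (5 + n) h → ((5 + n) * n + 7) / 8 + 1 ≤ h
genus-lower n h (R , big , euler) = bound h eight
  where
  F = numFaces R
  eight : 8 + (5 + n) * n ≤ 8 * h
  -- Doubling Euler's formula makes `4 F` appear. The added term `9 p + p n` is `4 p + p p` for
  -- `p = 5 + n`; having it on both sides avoids subtraction.
  eight = +-cancelʳ-≤ (9 * (5 + n) + (5 + n) * n) _ _ (begin
    8 + (5 + n) * n + (9 * (5 + n) + (5 + n) * n)        ≡⟨ left n ⟩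
    2 * (4 + (5 + n) * (4 + n)) + (5 + n)                ≡⟨ cong (λ k → 2 * k + (5 + n)) (sym euler) ⟩
    2 * (2 * (5 + n + F + 2 * h)) + (5 + n)              ≡⟨ middle n F h ⟩
    8 * h + 4 * (5 + n) + (4 * F + (5 + n))              ≤⟨ +-monoʳ-≤ (8 * h + 4 * (5 + n)) (numFaces-bound R big) ⟩
    8 * h + 4 * (5 + n) + (5 + n) * (5 + n)              ≡⟨ right n h ⟩
    8 * h + (9 * (5 + n) + (5 + n) * n)                  ∎)
    where
    open ≤-Reasoning
    left : ∀ n → 8 + (5 + n) * n + (9 * (5 + n) + (5 + n) * n) ≡ 2 * (4 + (5 + n) * (4 + n)) + (5 + n)
    left = solve-∀
    middle : ∀ n F h → 2 * (2 * (5 + n + F + 2 * h)) + (5 + n) ≡ 8 * h + 4 * (5 + n) + (4 * F + (5 + n))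
    middle = solve-∀
    right : ∀ n h → 8 * h + 4 * (5 + n) + (5 + n) * (5 + n) ≡ 8 * h + (9 * (5 + n) + (5 + n) * n)
    right = solve-∀
  bound : ∀ h → 8 + (5 + n) * n ≤ 8 * h → ((5 + n) * n + 7) / 8 + 1 ≤ h
  -- `h = 0` is excluded by `8 ≤ 8 h`. The successor absorbs the summand 1, and `8 h + 7` divided by
  -- 8 rounds down to `h`.
  bound (suc h) le = subst (_≤ suc h) (+-comm 1 _) (s≤s (begin
    ((5 + n) * n + 7) / 8
      ≤⟨ /-monoˡ-≤ 8 (+-monoˡ-≤ 7 (+-cancelˡ-≤ 8 _ _ (subst (8 + (5 + n) * n ≤_) (*-suc 8 h) le))) ⟩
    (8 * h + 7) / 8         ≡⟨ +-distrib-/-∣ˡ 7 (subst (8 ∣_) (*-comm h 8) (n∣m*n h)) ⟩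
    8 * h / 8 + 0           ≡⟨ +-identityʳ _ ⟩
    8 * h / 8               ≡⟨ cong (_/ 8) (*-comm 8 h) ⟩
    h * 8 / 8               ≡⟨ m*n/n≡m h 8 ⟩
    h                       ∎))
    where
    open ≤-Reasoning

-- Substituting `4 F = p (p - 1) - e` into Euler's formula gives `8 (h - 1) = p (p - 5) + e`.
genus-upper : ∀ n {e t} → (5 + n) * n + e ≡ 8 * t → Embedding e (5 + n) → EmbedsIn 4 (5 + n) (t + 1)
genus-upper n {e} {t} eq (R , big , faces) = R , big ,
  *-cancelˡ-≡ _ _ 2 (+-cancelʳ-≡ (5 + n) _ _ (begin
    2 * (2 * (5 + n + F + 2 * (t + 1))) + (5 + n)           ≡⟨ left n F t ⟩
    4 * (5 + n) + 8 + (4 * F + (5 + n)) + 8 * t             ≡⟨ cong (4 * (5 + n) + 8 + (4 * F + (5 + n)) +_) (sym eq) ⟩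
    4 * (5 + n) + 8 + (4 * F + (5 + n)) + ((5 + n) * n + e) ≡⟨ middle n F e ⟩
    4 * (5 + n) + 8 + (5 + n) * n + (4 * F + e + (5 + n))   ≡⟨ cong (4 * (5 + n) + 8 + (5 + n) * n +_) faces ⟩
    4 * (5 + n) + 8 + (5 + n) * n + (5 + n) * (5 + n)       ≡⟨ right n ⟩
    2 * (4 + (5 + n) * (4 + n)) + (5 + n)                   ∎))
  where
  open ≡-Reasoning
  F = numFaces R
  left : ∀ n F t → 2 * (2 * (5 + n + F + 2 * (t + 1))) + (5 + n) ≡ 4 * (5 + n) + 8 + (4 * F + (5 + n)) + 8 * t
  left = solve-∀
  middle : ∀ n F e → 4 * (5 + n) + 8 + (4 * F + (5 + n)) + ((5 + n) * n + e) ≡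
                     4 * (5 + n) + 8 + (5 + n) * n + (4 * F + e + (5 + n))
  middle = solve-∀
  right : ∀ n → 4 * (5 + n) + 8 + (5 + n) * n + (5 + n) * (5 + n) ≡ 2 * (4 + (5 + n) * (4 + n)) + (5 + n)
  right = solve-∀

-- Of the added 7, the part `e` completes `m` to `8 t`, and the remaining `7 - e` is lost in the
-- division.
ceiling : ∀ m {e t} → e ≤ 7 → m + e ≡ 8 * t → (m + 7) / 8 ≡ t
ceiling m {e} {t} e≤7 eq = begin
  (m + 7) / 8               ≡⟨ cong (λ k → (m + k) / 8) (sym (m+[n∸m]≡n e≤7)) ⟩
  (m + (e + (7 ∸ e))) / 8   ≡⟨ cong (_/ 8) (sym (+-assoc m e (7 ∸ e))) ⟩
  (m + e + (7 ∸ e)) / 8     ≡⟨ cong (λ k → (k + (7 ∸ e)) / 8) (trans eq (*-comm 8 t)) ⟩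
  (t * 8 + (7 ∸ e)) / 8     ≡⟨ +-distrib-/-∣ˡ (7 ∸ e) (n∣m*n t) ⟩
  t * 8 / 8 + (7 ∸ e) / 8   ≡⟨ cong₂ _+_ (m*n/n≡m t 8) (m<n⇒m/n≡0 (s≤s (m∸n≤m 7 e))) ⟩
  t + 0                     ≡⟨ +-identityʳ t ⟩
  t                         ∎
  where open ≡-Reasoning

genus : ∀ n {e t} → e ≤ 7 → (5 + n) * n + e ≡ 8 * t → Embedding e (5 + n) →
        NGenusComplete≡ 4 (5 + n) (((5 + n) * n + 7) / 8 + 1)
genus n {e} {t} e≤7 eq E =
  subst (λ q → EmbedsIn 4 (5 + n) (q + 1)) (sym (ceiling ((5 + n) * n) {t = t} e≤7 eq)) (genus-upper n {t = t} eq E) ,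
  genus-lower n

-- Here `p ∸ 5` is truncated to 0; the ceiling of `-4 / 8` is 0 as well, so the formula still gives
-- 1. On the sphere Euler's formula would force four faces, which need 16 darts where only 12 exist.
genus₄ : Embedding 4 4 → NGenusComplete≡ 4 4 1
genus₄ (R , big , faces) = (R , big , cong (λ F → 2 * (4 + F + 2)) two) , least
  where
  two : numFaces R ≡ 2
  two = *-cancelˡ-≡ _ 2 4 (+-cancelʳ-≡ 8 _ _ (trans (sym (+-assoc (4 * numFaces R) 4 4)) faces))
  least : ∀ h → EmbedsIn 4 4 h → 1 ≤ h
  least (suc h) _ = s≤s z≤n
  least zero (R , big , euler) =
    ⊥-elim (<⇒≱ {16} {20} (s≤s (m≤m+n 16 3)) (subst (λ F → 4 * F + 4 ≤ 16) four (numFaces-bound R big)))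
    where
    four : numFaces R ≡ 4
    four = trans (sym (+-identityʳ _)) (+-cancelˡ-≡ 4 _ _ (*-cancelˡ-≡ _ 8 2 euler))

record Base (j : ℕ) : Set where
  constructor base
  field
    {h}    : Bool
    {e t}  : ℕ
    gadget : Gadget h
    e≤7    : e ≤ 7
    ceil   : (7 + j) * (2 + j) + e ≡ 8 * t
    start  : SeedState h (7 + j) e

bases : ∀ (j : Fin 8) → Base (toℕ j)
bases 0F = base {t = 2} oddGadget (m≤m+n 2 5) refl state7
bases 1F = base {t = 3} evenGadget (m≤m+n 0 7) refl state8
bases 2F = base {t = 5} oddGadget (m≤m+n 4 3) refl state9
bases 3F = base {t = 7} evenGadget (m≤m+n 6 1) refl state10
bases 4F = base {t = 9} oddGadget (m≤m+n 6 1) refl state11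
bases 5F = base {t = 11} evenGadget (m≤m+n 4 3) refl state12
bases 6F = base {t = 13} oddGadget (m≤m+n 0 7) refl state13
bases 7F = base {t = 16} evenGadget (m≤m+n 2 5) refl state14

large : ∀ m {j} → Base j → let n = m * 8 + (2 + j) in NGenusComplete≡ 4 (5 + n) (((5 + n) * n + 7) / 8 + 1)
large m {j} (base {h} {e} {t} gadget e≤7 ceil start) =
  -- From `p = 7 + j` to `p = 8 m + 7 + j` the number `p (p - 5)` grows by
  -- `8 (m (9 + 2 j) + 8 m m)`, so `e` stays and `t` absorbs the growth.
  genus (m * 8 + (2 + j)) {t = t + m * (9 + 2 * j) + 8 * m * m} e≤7 (begin
      (5 + (m * 8 + (2 + j))) * (m * 8 + (2 + j)) + e            ≡⟨ left m j e ⟩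
      (7 + j) * (2 + j) + e + 8 * (m * (9 + 2 * j) + 8 * m * m)  ≡⟨ cong (_+ 8 * (m * (9 + 2 * j) + 8 * m * m)) ceil ⟩
      8 * t + 8 * (m * (9 + 2 * j) + 8 * m * m)                  ≡⟨ right m j t ⟩
      8 * (t + m * (9 + 2 * j) + 8 * m * m)                      ∎)
    (subst (Embedding e) (shift m j)
      (embedding (≤-trans (m≤m+n 3 (4 + j)) (m≤n+m (7 + j) (m * 8))) (tower gadget start m)))
  where
  open ≡-Reasoning
  left : ∀ m j e → (5 + (m * 8 + (2 + j))) * (m * 8 + (2 + j)) + e ≡
                   (7 + j) * (2 + j) + e + 8 * (m * (9 + 2 * j) + 8 * m * m)
  left = solve-∀
  right : ∀ m j t → 8 * t + 8 * (m * (9 + 2 * j) + 8 * m * m) ≡ 8 * (t + m * (9 + 2 * j) + 8 * m * m)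
  right = solve-∀
  shift : ∀ m j → m * 8 + (7 + j) ≡ 5 + (m * 8 + (2 + j))
  shift = solve-∀

theorem1 : ∀ (p : ℕ) → 4 ≤ p → NGenusComplete≡ 4 p ((p * (p ∸ 5) + 7) / 8 + 1)
theorem1 0 ()
theorem1 1 (s≤s ())
theorem1 2 (s≤s (s≤s ()))
theorem1 3 (s≤s (s≤s (s≤s ())))
theorem1 4 _ = genus₄ embedding₄
theorem1 5 _ = genus 0 {t = 0} z≤n refl embedding₅
theorem1 6 _ = genus 1 {t = 1} (m≤m+n 2 5) refl embedding₆
theorem1 (suc (suc (suc (suc (suc (suc (suc q))))))) _ with q divMod 8
... | result m j eq = subst (λ n → NGenusComplete≡ 4 (5 + n) (((5 + n) * n + 7) / 8 + 1)) split (large m (bases j))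
  where
  split : m * 8 + (2 + toℕ j) ≡ 2 + q
  split = trans (shuffle (m * 8) (toℕ j)) (cong (2 +_) (sym eq))
    where
    shuffle : ∀ x y → x + (2 + y) ≡ 2 + (y + x)
    shuffle = solve-∀
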